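{- For every $n\in\mathbb{N}$ (i.e. $n\ge1$), the generating function of the renormalized values satisfies, in $\mathbb{C}[[t_1,\dots,t_n]]$, $$Z_{\mathrm{EMS}}(t_1,\dots,t_n)=\prod_{i=1}^n\frac{(t_i+\cdots+t_n)-(e^{t_i+\cdots+t_n}-1)}{(t_i+\cdots+t_n)(e^{t_i+\cdots+t_n}-1)},$$ where $\frac{u-(e^u-1)}{u(e^u-1)}$ is understood as a power series in $u$. Equivalently, for all $k_1,\dots,k_n\in\mathbb{N}_0$, $$\zeta_{\mathrm{EMS}}(-k_1,\dots,-k_n)=(-1)^{k_1+\cdots+k_n}\sum_{\substack{\nu_{1i}+\cdots+\nu_{ii}=k_i\\1\leq i\leq n}}\ \prod_{i=1}^n\frac{k_i!}{\prod_{j=i}^n\nu_{ij}!}\,\frac{B_{\nu_{ii}+\cdots+\nu_{in}+1}}{\nu_{ii}+\cdots+\nu_{in}+1},$$ where the sum runs over all families of non-negative integers $(\nu_{ij})_{1\le i\le j\le n}$ with $\nu_{1i}+\nu_{2i}+\cdots+\nu_{ii}=k_i$ for each $1\le i\le n$, and $B_m$ are the Bernoulli numbers.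
   Context: $\mathbb{N}=\{1,2,\dots\}$, $\mathbb{N}_0=\{0,1,2,\dots\}$. Bernoulli numbers: $\frac{x}{e^x-1}=\sum_{m\ge0}\frac{B_m}{m!}x^m$ (so $B_1=-\frac12$). **Generating function.** $$Z_{\mathrm{EMS}}(t_1,\dots,t_n):=\sum_{k_1,\dots,k_n=0}^{\infty}\frac{(-t_1)^{k_1}\cdots(-t_n)^{k_n}}{k_1!\cdots k_n!}\,\zeta_{\mathrm{EMS}}(-k_1,\dots,-k_n)\in\mathbb{C}[[t_1,\dots,t_n]].$$ **Renormalized values.** Let $L=\{d,y\}$, let $L^*$ be the free monoid on $L$ with unit the empty word $\mathbf{1}$, and $\mathbb{Q}\langle L\rangle$ the $\mathbb{Q}$-span of $L^*$. Put $Y:=L^*y\cup\{\mathbf{1}\}$. Define a $\mathbb{Q}$-bilinear product $\sqcup\!\sqcup_0$ on $\mathbb{Q}\langle L\rangle$ recursively, for words $u,v,w\in L^*$, by $\mathbf 1\sqcup\!\sqcup_0 w=w\sqcup\!\sqcup_0\mathbf 1=w$; $\ yu\sqcup\!\sqcup_0 v=u\sqcup\!\sqcup_0 yv=y(u\sqcup\!\sqcup_0 v)$; $\ du\sqcup\!\sqcup_0 dv=d(u\sqcup\!\sqcup_0 dv)-u\sqcup\!\sqcup_0 d^2v$. Let $\mathcal{T}_-$ be the linear span of $\{wd\mid w\in L^*\}$; let $\mathcal{L}_-$ be the two-sided ideal of $(\mathbb{Q}\langle L\rangle,\sqcup\!\sqcup_0)$ generated by all $d^k\{d(u\sqcup\!\sqcup_0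 v)-du\sqcup\!\sqcup_0 v-u\sqcup\!\sqcup_0 dv\}$ with $k\in\mathbb{N}_0$, $u,v\in L^*$; put $\mathcal{S}_-:=\mathcal{T}_-+\mathcal{L}_-$ (a two-sided ideal) and $\mathcal{H}_0:=\mathbb{Q}\langle L\rangle/\mathcal{S}_-$. It is known (Ebrahimi-Fard–Manchon–Singer) that $\mathcal{H}_0$ is a connected filtered commutative and cocommutative Hopf algebra with product $\sqcup\!\sqcup_0$ and coproduct given, for $w=x_1\cdots x_N\in Y\setminus\{\mathbf 1\}$ ($x_i\in L$), by $\Delta_0(w)=\sum_{S}w_S\otimes w_{\overline S}$, the sum being over all $S\subset\{1,\dots,N\}$ (possibly empty) such that $w_S,w_{\overline S}\in Y$, where $\overline S$ is the complement of $S$ and $w_S:=x_{i_1}\cdots x_{i_r}$ for $S=\{i_1<\cdots<i_r\}$. The counit $\varepsilon$ satisfies $\varepsilon(\mathbf 1)=1$ and $\varepsilon(w)=0$ for $w\in Y\setminus\{\mathbf 1\}$. Let $\mathcal{A}:=\mathbb{Q}[[z]][\frac1z]=\mathcal{A}_-\oplus\mathcal{A}_+$ with $\mathcal{A}_-=\frac1z\mathbb{Q}[\frac1z]$, $\mathcal{A}_+=\mathbb{Q}[[z]]$. For linear maps $\alpha,\beta:\mathcal{H}_0\to\mathcal{A}$ the convolution is $\alpha*\beta:=m_{\mathcal{A}}\circ(\alpha\otimes\beta)\circ\Delta_0$; the linear maps with $\mathbf 1\mapsto1$ form a group under $*$. Let $\phi:\mathcal{H}_0\to\mathcal{A}$ be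 the linear map with $\phi(\mathbf 1)=1$ and $\phi(d^{k_1}y\cdots d^{k_n}y)(z)=\partial_z^{k_1}(x\partial_z^{k_2})\cdots(x\partial_z^{k_n})(x)$, $x=x(z)=\frac{e^z}{1-e^z}$ (known to be a well-defined algebra homomorphism). By the algebraic Birkhoff decomposition there are unique linear maps $\phi_+:\mathcal{H}_0\to\mathcal{A}_+$ and $\phi_-:\mathcal{H}_0\to\mathbb{Q}\oplus\mathcal{A}_-$ with $\phi_-(\mathbf 1)=1$, $\phi_-(\ker\varepsilon)\subset\mathcal{A}_-$ and $\phi=\phi_-^{ -1}*\phi_+$ (inverse with respect to $*$); both are algebra homomorphisms. The renormalized value is $$\zeta_{\mathrm{EMS}}(-k_1,\dots,-k_n):=\lim_{z\to0}\phi_+(d^{k_n}y\cdots d^{k_1}y)(z)\qquad(k_1,\dots,k_n\in\mathbb{N}_0).$$ -}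

module Defs where

open import Algebra.Module.Bundles.Raw using (RawLeftModule)
open import Algebra.Module.Morphism.Structures using (module LeftModuleMorphisms)
open import Data.Bool using (Bool; true; false; if_then_else_; _∧_)
open import Data.Fin as Fin using (Fin)
import Data.Fin.Properties as Fin
open import Data.Integer as ℤ using (ℤ; +_; -[1+_]; 0ℤ)
open import Data.List
  using (List; []; _∷_; [_]; _++_; map; foldr; concatMap; cartesianProductWith;
         replicate; upTo; allFin; filter; filterᵇ)
import Data.List.Properties as List
open import Data.List.Membership.Propositional using (_∈_; find)
open import Data.List.Membership.Propositional.Properties
  using (∈-map⁺; ∈-map⁻; ∈-upTo⁺; ∈-upTo⁻; ∈-concatMap⁺; ∈-concatMap⁻;
         ∈-cartesianProductWith⁺; ∈-cartesianProductWith⁻)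
open import Data.List.Relation.Binary.Disjoint.Propositional using (Disjoint)
import Data.List.Relation.Unary.All as All
import Data.List.Relation.Unary.All.Properties as All
open import Data.List.Relation.Unary.AllPairs as AllPairs using ([]; _∷_)
import Data.List.Relation.Unary.AllPairs.Properties as AllPairs
open import Data.List.Relation.Unary.All using ([]; _∷_)
open import Data.List.Relation.Unary.Any as Any using (here; there)
open import Data.List.Relation.Unary.Unique.Propositional using (Unique)
import Data.List.Relation.Unary.Unique.Propositional.Properties as Unique
open import Data.Nat as ℕ using (ℕ; zero; suc; _∸_; _!)
open import Data.Nat.Properties using (_!≢0)
import Data.Nat.Properties as ℕ
open import Data.Product using (∃₂; _×_; _,_)
open import Data.Rational as ℚ using (ℚ; 0ℚ; 1ℚ)
open import Data.Vec as Vec using (Vec; []; _∷_)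
import Data.Vec.Properties as Vec
open import Level using (0ℓ)
open import Relation.Binary using (DecidableEquality)
open import Relation.Binary.PropositionalEquality as ≡
  using (_≡_; _≢_; refl; sym; trans; cong; cong₂)
open import Relation.Nullary using (yes; no; does)

------------------------------------------------------------------------
-- Finite sums in ℚ

∑ : {I : Set} → List I → (I → ℚ) → ℚ
∑ is f = foldr (λ i s → f i ℚ.+ s) 0ℚ is

fromℕ : ℕ → ℚ
fromℕ n = + n ℚ./ 1

fromℤ : ℤ → ℚ
fromℤ i = i ℚ./ 1

1/[_]! : ℕ → ℚ
1/[ n ]! = (+ 1 ℚ./ n !) {{n !≢0}}

-1^ : ℕ → ℚ
-1^ zero    = 1ℚ
-1^ (suc n) = ℚ.- -1^ n

------------------------------------------------------------------------
-- ℚ[[z]], a series being its sequence of coefficients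

Series : Set
Series = ℕ → ℚ

infixl 7 _⊛_
infixl 6 _⊕_ _⊖_

_⊕_ _⊖_ _⊛_ : Series → Series → Series
(f ⊕ g) n = f n ℚ.+ g n
(f ⊖ g) n = f n ℚ.- g n
(f ⊛ g) n = ∑ (upTo (suc n)) λ k → f k ℚ.* g (n ∸ k)

const : ℚ → Series
const c zero    = c
const c (suc _) = 0ℚ

X : Series
X 1 = 1ℚ
X _ = 0ℚ

pow : Series → ℕ → Series
pow f zero    = const 1ℚ
pow f (suc m) = f ⊛ pow f m

-- z f(z).
mulZ : Series → Series
mulZ f zero    = 0ℚ
mulZ f (suc n) = f n

-- f(z) / z; only applied to series without constant term.
divZ : Series → Series
divZ f n = f (suc n)

-- The inverse of a series f with f 0 ≡ 1, as the geometric series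
-- Σⱼ (1 - f)ʲ: the j-th term has order at least j, so the terms with j ≤ n
-- determine the n-th coefficient.
inv : Series → Series
inv f n = ∑ (upTo (suc n)) λ j → pow (const 1ℚ ⊖ f) j n

exp : Series
exp n = 1/[ n ]!

-- eᵘ - 1
expm1 : Series
expm1 = exp ⊖ const 1ℚ

-- Bernoulli numbers: x / (eˣ - 1) = Σ Bₘ xᵐ / m!.
B : ℕ → ℚ
B m = fromℕ (m !) ℚ.* inv (divZ expm1) m

-- (u - (eᵘ - 1)) / (u (eᵘ - 1)), numerator and denominator divided by u².
factor : Series
factor = divZ (divZ (X ⊖ expm1)) ⊛ inv (divZ expm1)

------------------------------------------------------------------------
-- 𝒜 = ℚ[[z]][1/z]

infix 8 _/z^_

-- num /z^ pole denotes num(z) / z^pole.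
record 𝒜 : Set where
  constructor _/z^_
  field
    num  : Series
    pole : ℕ

open 𝒜 public

coeff : 𝒜 → ℤ → ℚ
coeff (f /z^ N) i = extend (i ℤ.+ + N)
  where
  extend : ℤ → ℚ
  extend (+ n)    = f n
  extend -[1+ _ ] = 0ℚ

infix 4 _≈_

_≈_ : 𝒜 → 𝒜 → Set
a ≈ b = ∀ i → coeff a i ≡ coeff b i

mulZ^ : ℕ → Series → Series
mulZ^ zero    f = f
mulZ^ (suc m) f = mulZ (mulZ^ m f)

infixl 7 _*ᴬ_
infixl 6 _+ᴬ_
infixr 7 _·ᴬ_

ι : Series → 𝒜
ι f = f /z^ 0

0ᴬ 1ᴬ : 𝒜
0ᴬ = ι (const 0ℚ)
1ᴬ = ι (const 1ℚ)

_·ᴬ_ : ℚ → 𝒜 → 𝒜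
c ·ᴬ (f /z^ N) = (λ n → c ℚ.* f n) /z^ N

-ᴬ_ : 𝒜 → 𝒜
-ᴬ (f /z^ N) = (λ n → ℚ.- f n) /z^ N

_+ᴬ_ _*ᴬ_ : 𝒜 → 𝒜 → 𝒜
(f /z^ N) +ᴬ (g /z^ M) = (mulZ^ M f ⊕ mulZ^ N g) /z^ (N ℕ.+ M)
(f /z^ N) *ᴬ (g /z^ M) = (f ⊛ g) /z^ (N ℕ.+ M)

∑ᴬ : {I : Set} → List I → (I → 𝒜) → 𝒜
∑ᴬ is f = foldr (λ i s → f i +ᴬ s) 0ᴬ is

-- d/dz, termwise on Σₙ fₙ zⁿ⁻ᴺ.
∂ : 𝒜 → 𝒜
∂ (f /z^ N) = (λ n → fromℤ (+ n ℤ.- + N) ℚ.* f n) /z^ (suc N)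

-- The subspaces 𝒜₊ = ℚ[[z]], 𝒜₋ = z⁻¹ℚ[z⁻¹] and ℚ ⊕ 𝒜₋.
𝒜₊ 𝒜₋ ℚ⊕𝒜₋ : 𝒜 → Set
𝒜₊ a   = ∀ i → i ℤ.< 0ℤ → coeff a i ≡ 0ℚ
𝒜₋ a   = ∀ i → 0ℤ ℤ.≤ i → coeff a i ≡ 0ℚ
ℚ⊕𝒜₋ a = ∀ i → 0ℤ ℤ.< i → coeff a i ≡ 0ℚ

-- The limit at z → 0 of an element of 𝒜₊.
lim₀ : 𝒜 → ℚ
lim₀ a = coeff a 0ℤ

-- x(z) = eᶻ / (1 - eᶻ) = - z⁻¹ · eᶻ · ((eᶻ - 1) / z)⁻¹
x : 𝒜
x = -ᴬ ((exp ⊛ inv (divZ expm1)) /z^ 1)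

------------------------------------------------------------------------
-- ℚ⟨L⟩

data Letter : Set where
  d y : Letter

Word : Set
Word = List Letter

_≟ᴸ_ : DecidableEquality Letter
d ≟ᴸ d = yes refl
d ≟ᴸ y = no λ ()
y ≟ᴸ d = no λ ()
y ≟ᴸ y = yes refl

_≟ᵂ_ : DecidableEquality Word
_≟ᵂ_ = List.≡-dec _≟ᴸ_

-- Formal ℚ-linear combinations of words, compared by their coefficients.
ℚ⟨L⟩ : Set
ℚ⟨L⟩ = List (ℚ × Word)

⟨_⟩ : Word → ℚ⟨L⟩
⟨ w ⟩ = [ (1ℚ , w) ]

coeffᵂ : ℚ⟨L⟩ → Word → ℚ
coeffᵂ p w = ∑ p λ (c , u) → if does (u ≟ᵂ w) then c else 0ℚ

infix 4 _≈ᵂ_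

_≈ᵂ_ : ℚ⟨L⟩ → ℚ⟨L⟩ → Set
p ≈ᵂ q = ∀ w → coeffᵂ p w ≡ coeffᵂ q w

infixl 6 _+ᵂ_ _-ᵂ_
infixr 7 _·ᵂ_

0ᵂ : ℚ⟨L⟩
0ᵂ = []

_+ᵂ_ _-ᵂ_ : ℚ⟨L⟩ → ℚ⟨L⟩ → ℚ⟨L⟩
_·ᵂ_ : ℚ → ℚ⟨L⟩ → ℚ⟨L⟩
negᵂ : ℚ⟨L⟩ → ℚ⟨L⟩
p +ᵂ q = p ++ q
c ·ᵂ p = map (λ (a , w) → (c ℚ.* a , w)) p
negᵂ p = (ℚ.- 1ℚ) ·ᵂ p
p -ᵂ q = p +ᵂ negᵂ q

-- Concatenation with a letter on the left, extended linearly.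
infixr 8 _▹_

_▹_ : Letter → ℚ⟨L⟩ → ℚ⟨L⟩
l ▹ p = map (λ (c , w) → (c , l ∷ w)) p

d^_▹_ : ℕ → ℚ⟨L⟩ → ℚ⟨L⟩
d^ zero  ▹ p = p
d^ suc k ▹ p = d ▹ (d^ k ▹ p)

------------------------------------------------------------------------
-- The product of ℚ⟨L⟩

infixl 7 _⧢_ _⧢ᵂ_

_⧢_ : Word → Word → ℚ⟨L⟩
[]      ⧢ v       = ⟨ v ⟩
(y ∷ u) ⧢ v       = y ▹ (u ⧢ v)
(d ∷ u) ⧢ []      = ⟨ d ∷ u ⟩
(d ∷ u) ⧢ (y ∷ v) = y ▹ ((d ∷ u) ⧢ v)
(d ∷ u) ⧢ (d ∷ v) = d ▹ (u ⧢ (d ∷ v)) -ᵂ u ⧢ (d ∷ d ∷ v)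

-- The clauses above satisfy the defining relations u ⧢ yv = y(u ⧢ v) and
-- u ⧢ 1 = u also where they are not listed.
⧢-yʳ : ∀ u v → u ⧢ (y ∷ v) ≡ y ▹ (u ⧢ v)
⧢-yʳ []      v = refl
⧢-yʳ (y ∷ u) v = cong (y ▹_) (⧢-yʳ u v)
⧢-yʳ (d ∷ u) v = refl

⧢-identityʳ : ∀ u → u ⧢ [] ≡ ⟨ u ⟩
⧢-identityʳ []      = refl
⧢-identityʳ (y ∷ u) = cong (y ▹_) (⧢-identityʳ u)
⧢-identityʳ (d ∷ u) = refl

_⧢ᵂ_ : ℚ⟨L⟩ → ℚ⟨L⟩ → ℚ⟨L⟩
p ⧢ᵂ q = concatMap (λ (a , u) → concatMap (λ (b , v) → (a ℚ.* b) ·ᵂ (u ⧢ v)) q) p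

------------------------------------------------------------------------
-- ℋ₀ = ℚ⟨L⟩ / 𝒮₋

-- 𝒯₋, the linear span of the words ending in d.
data 𝒯₋ : ℚ⟨L⟩ → Set where
  word : ∀ w → 𝒯₋ ⟨ w ++ [ d ] ⟩
  zero : 𝒯₋ 0ᵂ
  add  : ∀ {p q} → 𝒯₋ p → 𝒯₋ q → 𝒯₋ (p +ᵂ q)
  mul  : ∀ c {p} → 𝒯₋ p → 𝒯₋ (c ·ᵂ p)
  resp : ∀ {p q} → p ≈ᵂ q → 𝒯₋ p → 𝒯₋ q

-- ℒ₋, the two-sided ideal generated by the failure of d to be a derivation.
data ℒ₋ : ℚ⟨L⟩ → Set where
  leibniz : ∀ k u v →
            ℒ₋ (d^ k ▹ (d ▹ (u ⧢ v) -ᵂ (d ∷ u) ⧢ v -ᵂ u ⧢ (d ∷ v)))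
  zero : ℒ₋ 0ᵂ
  add  : ∀ {p q} → ℒ₋ p → ℒ₋ q → ℒ₋ (p +ᵂ q)
  mul  : ∀ c {p} → ℒ₋ p → ℒ₋ (c ·ᵂ p)
  mulˡ : ∀ r {p} → ℒ₋ p → ℒ₋ (r ⧢ᵂ p)
  mulʳ : ∀ r {p} → ℒ₋ p → ℒ₋ (p ⧢ᵂ r)
  resp : ∀ {p q} → p ≈ᵂ q → ℒ₋ p → ℒ₋ q

𝒮₋ : ℚ⟨L⟩ → Set
𝒮₋ p = ∃₂ λ t l → 𝒯₋ t × ℒ₋ l × p ≈ᵂ t +ᵂ l

-- The quotient is ℚ⟨L⟩ with congruence modulo 𝒮₋ as its equality.
ℋ₀ : RawLeftModule ℚ 0ℓ 0ℓ
ℋ₀ = record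
  { Carrierᴹ = ℚ⟨L⟩
  ; _≈ᴹ_     = λ p q → 𝒮₋ (p -ᵂ q)
  ; _+ᴹ_     = _+ᵂ_
  ; _*ₗ_     = _·ᵂ_
  ; 0ᴹ       = 0ᵂ
  ; -ᴹ_      = negᵂ
  }

𝒜-rawLeftModule : RawLeftModule ℚ 0ℓ 0ℓ
𝒜-rawLeftModule = record
  { Carrierᴹ = 𝒜
  ; _≈ᴹ_     = _≈_
  ; _+ᴹ_     = _+ᴬ_
  ; _*ₗ_     = _·ᴬ_
  ; 0ᴹ       = 0ᴬ
  ; -ᴹ_      = -ᴬ_
  }

-- Linear maps ℋ₀ → 𝒜.
IsLinear : (ℚ⟨L⟩ → 𝒜) → Set
IsLinear = LeftModuleMorphisms.IsLeftModuleHomomorphism ℋ₀ 𝒜-rawLeftModule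

------------------------------------------------------------------------
-- Coproduct and convolution

-- Membership in Y = L*y ∪ {1}.
inY : Word → Bool
inY []              = true
inY (d ∷ [])        = false
inY (y ∷ [])        = true
inY (_ ∷ w@(_ ∷ _)) = inY w

-- All pairs (w_S , w_S̄), S ranging over the subsets of the positions of w.
splits : Word → List (Word × Word)
splits []      = [ ([] , []) ]
splits (l ∷ w) = map (λ (u , v) → (l ∷ u , v)) (splits w)
              ++ map (λ (u , v) → (u , l ∷ v)) (splits w)

-- Each element of the list stands for a summand u ⊗ v. The words outside Y
-- vanish in ℋ₀; for them the list is empty, since the final d lies in w_S or
-- in w_S̄.
Δ₀ : Word → List (Word × Word)
Δ₀ w = filterᵇ (λ (u , v) → inY u ∧ inY v) (splits w)

linear : (Word → 𝒜) → ℚ⟨L⟩ → 𝒜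
linear f p = ∑ᴬ p λ (c , w) → c ·ᴬ f w

infixl 7 _⋆_

_⋆_ : (ℚ⟨L⟩ → 𝒜) → (ℚ⟨L⟩ → 𝒜) → ℚ⟨L⟩ → 𝒜
α ⋆ β = linear λ w → ∑ᴬ (Δ₀ w) λ (u , v) → α ⟨ u ⟩ *ᴬ β ⟨ v ⟩

-- The counit; it vanishes on every nonempty word.
ε : ℚ⟨L⟩ → ℚ
ε p = coeffᵂ p []

-- The neutral element of ⋆.
𝟏⋆ : ℚ⟨L⟩ → 𝒜
𝟏⋆ p = ε p ·ᴬ 1ᴬ

------------------------------------------------------------------------
-- Birkhoff decomposition and renormalized values

-- For the final y of d^{k₁} y ⋯ d^{kₙ} y the factor is x · 1 = x. Words ending
-- in d are sent to a derivative of 1, i.e. to 0.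
φʷ : Word → 𝒜
φʷ []      = 1ᴬ
φʷ (d ∷ w) = ∂ (φʷ w)
φʷ (y ∷ w) = x *ᴬ φʷ w

φ : ℚ⟨L⟩ → 𝒜
φ = linear φʷ

infix 4 _≐_

_≐_ : (ℚ⟨L⟩ → 𝒜) → (ℚ⟨L⟩ → 𝒜) → Set
α ≐ β = ∀ p → α p ≈ β p

record BirkhoffDecomposition : Set where
  field
    φ₊ φ₋ φ₋⁻¹  : ℚ⟨L⟩ → 𝒜
    φ₊-linear   : IsLinear φ₊
    φ₊-range    : ∀ p → 𝒜₊ (φ₊ p)
    φ₋-linear   : IsLinear φ₋
    φ₋-range    : ∀ p → ℚ⊕𝒜₋ (φ₋ p)
    φ₋-unit     : φ₋ ⟨ [] ⟩ ≈ 1ᴬ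
    φ₋-kerε     : ∀ p → ε p ≡ 0ℚ → 𝒜₋ (φ₋ p)
    φ₋⁻¹-linear : IsLinear φ₋⁻¹
    φ₋⁻¹-unit   : φ₋⁻¹ ⟨ [] ⟩ ≈ 1ᴬ
    inverseˡ    : φ₋⁻¹ ⋆ φ₋ ≐ 𝟏⋆
    inverseʳ    : φ₋ ⋆ φ₋⁻¹ ≐ 𝟏⋆
    decompose   : φ ≐ φ₋⁻¹ ⋆ φ₊

-- d^{kₙ} y ⋯ d^{k₁} y, with the indices reversed.
argument : ∀ {n} → Vec ℕ n → Word
argument []       = []
argument (k ∷ ks) = argument ks ++ replicate k d ++ [ y ]

-- ζ-EMS D (k₁ , … , kₙ) is ζ_EMS(-k₁, …, -kₙ).
ζ-EMS : BirkhoffDecomposition → ∀ {n} → Vec ℕ n → ℚ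
ζ-EMS D ks = lim₀ (BirkhoffDecomposition.φ₊ D ⟨ argument ks ⟩)

------------------------------------------------------------------------
-- ℚ[[t₁, …, tₙ]], a series being its family of coefficients

MSeries : ℕ → Set
MSeries n = Vec ℕ n → ℚ

-- The exponent vectors that are componentwise at most k.
below : ∀ {n} → Vec ℕ n → List (Vec ℕ n)
below []       = [ [] ]
below (k ∷ ks) = cartesianProductWith _∷_ (upTo (suc k)) (below ks)

module _ {n : ℕ} where

  infixl 7 _⊗_

  _⊗_ : MSeries n → MSeries n → MSeries n
  (f ⊗ g) k = ∑ (below k) λ a → f a ℚ.* g (Vec.zipWith _∸_ k a)

  monomial : Vec ℕ n → MSeries n
  monomial a k = if does (Vec.≡-dec ℕ._≟_ a k) then 1ℚ else 0ℚ

  𝟙 : MSeries n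
  𝟙 = monomial (Vec.replicate n 0)

  t : Fin n → MSeries n
  t i = monomial (Vec.replicate n 0 Vec.[ i ]≔ 1)

  mpow : MSeries n → ℕ → MSeries n
  mpow f zero    = 𝟙
  mpow f (suc m) = f ⊗ mpow f m

  -- tᵢ + ⋯ + tₙ
  tailSum : Fin n → MSeries n
  tailSum i k = ∑ (filter (i Fin.≤?_) (allFin n)) λ j → t j k

  -- f(u) for u without constant term: uᵐ has order at least m, so the powers
  -- with m ≤ |k| determine the coefficient at k.
  substitute : Series → MSeries n → MSeries n
  substitute f u k = ∑ (upTo (suc (Vec.sum k))) λ m → f m ℚ.* mpow u m k

  ∏ᴹ : List (Fin n) → (Fin n → MSeries n) → MSeries n
  ∏ᴹ is f = foldr (λ i g → f i ⊗ g) 𝟙 is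

-- The coefficient at t^k carries ∏ᵢ (-1)^{kᵢ} / kᵢ!.
Z-EMS : BirkhoffDecomposition → ∀ n → MSeries n
Z-EMS D n k = Vec.foldr′ (λ kᵢ r → (-1^ kᵢ ℚ.* 1/[ kᵢ ]!) ℚ.* r) 1ℚ k ℚ.* ζ-EMS D k

------------------------------------------------------------------------
-- Families (νᵢⱼ) with 1 ≤ i ≤ j ≤ n

-- An element of Triangle (suc n) is its first row ν₁₁, …, ν₁,ₙ₊₁ followed by
-- the triangle of the νᵢⱼ with 2 ≤ i ≤ j.
data Triangle : ℕ → Set where
  []  : Triangle 0
  _∷_ : ∀ {n} → Vec ℕ (suc n) → Triangle n → Triangle (suc n)

-- Its entries are the sums ν₁ⱼ + ⋯ + νⱼⱼ.
columnSums : ∀ {n} → Triangle n → Vec ℕ n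
columnSums []            = []
columnSums ((a ∷ r) ∷ ν) = a ∷ Vec.zipWith ℕ._+_ r (columnSums ν)

-- The families with given column sums: ν₁₁ is k₁, the rest r of the first row
-- is bounded by (k₂, …, kₙ), and the remaining rows have column sums
-- (k₂, …, kₙ) - r. By the three lemmas below, the list runs exactly once
-- through the families with column sums k.
families : ∀ {n} → Vec ℕ n → List (Triangle n)
families []       = [ [] ]
families (k ∷ ks) =
  concatMap (λ r → map ((k ∷ r) ∷_) (families (Vec.zipWith _∸_ ks r))) (below ks)

∈-below⁺ : ∀ {n} (a b : Vec ℕ n) → a ∈ below (Vec.zipWith ℕ._+_ a b)
∈-below⁺ []       []       = here refl
∈-below⁺ (a ∷ as) (b ∷ bs) =
  ∈-cartesianProductWith⁺ _∷_ (∈-upTo⁺ (ℕ.s≤s (ℕ.m≤m+n a b))) (∈-below⁺ as bs)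

below-+-∸ : ∀ {n} {k a : Vec ℕ n} → a ∈ below k →
            Vec.zipWith ℕ._+_ a (Vec.zipWith _∸_ k a) ≡ k
below-+-∸ {k = []}     {[]}     _ = refl
below-+-∸ {k = k ∷ ks} a∈ with ∈-cartesianProductWith⁻ _∷_ (upTo (suc k)) (below ks) a∈
... | _ , _ , a∈k , as∈ks , refl =
  cong₂ _∷_ (ℕ.m+[n∸m]≡n (ℕ.≤-pred (∈-upTo⁻ a∈k))) (below-+-∸ as∈ks)

+-∸-cancel : ∀ {n} (a b : Vec ℕ n) → Vec.zipWith _∸_ (Vec.zipWith ℕ._+_ a b) a ≡ b
+-∸-cancel []       []       = refl
+-∸-cancel (a ∷ as) (b ∷ bs) = cong₂ _∷_ (ℕ.m+n∸m≡n a b) (+-∸-cancel as bs)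

families-complete : ∀ {n} (ν : Triangle n) → ν ∈ families (columnSums ν)
families-complete []            = here refl
families-complete ((a ∷ r) ∷ ν) =
  ∈-concatMap⁺ _ (Any.map
    (λ { refl → ∈-map⁺ ((a ∷ r) ∷_)
                  (≡.subst (λ k → ν ∈ families k) (sym (+-∸-cancel r (columnSums ν)))
                    (families-complete ν)) })
    (∈-below⁺ r (columnSums ν)))

families-sound : ∀ {n} (k : Vec ℕ n) {ν} → ν ∈ families k → columnSums ν ≡ k
families-sound []       (here refl) = refl
families-sound (k ∷ ks) ν∈
  with find (∈-concatMap⁻ (λ r → map ((k ∷ r) ∷_) (families (Vec.zipWith _∸_ ks r))) {xs = below ks} ν∈)
... | r , r∈ , ν∈r with ∈-map⁻ ((k ∷ r) ∷_) ν∈r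
... | ν′ , ν′∈ , refl = cong (k ∷_)
  (trans (cong (Vec.zipWith ℕ._+_ r) (families-sound _ ν′∈)) (below-+-∸ r∈))

below-unique : ∀ {n} (k : Vec ℕ n) → Unique (below k)
below-unique []       = [] ∷ []
below-unique (k ∷ ks) =
  Unique.cartesianProductWith⁺ _∷_ Vec.∷-injective (Unique.upTo⁺ (suc k)) (below-unique ks)

families-unique : ∀ {n} (k : Vec ℕ n) → Unique (families k)
families-unique []       = [] ∷ []
families-unique (k ∷ ks) = Unique.concat⁺
  (All.map⁺ (All.universal
    (λ r → Unique.map⁺ (λ { refl → refl }) (families-unique (Vec.zipWith _∸_ ks r)))
    (below ks)))
  (AllPairs.map⁺ (AllPairs.map disjoint (below-unique ks)))
  where
  rows : ∀ r → List (Triangle _)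
  rows r = map ((k ∷ r) ∷_) (families (Vec.zipWith _∸_ ks r))
  disjoint : ∀ {r s} → r ≢ s → Disjoint (rows r) (rows s)
  disjoint r≢s (ν∈r , ν∈s) with ∈-map⁻ _ ν∈r | ∈-map⁻ _ ν∈s
  ... | _ , _ , refl | _ , _ , refl = r≢s refl

-- ∏ᵢ kᵢ! / (νᵢᵢ! ⋯ νᵢₙ!) · B_{m+1} / (m+1) with m = νᵢᵢ + ⋯ + νᵢₙ.
summand : ∀ {n} → Vec ℕ n → Triangle n → ℚ
summand []       []      = 1ℚ
summand (k ∷ ks) (r ∷ ν) =
  fromℕ (k !) ℚ.* Vec.foldr′ (λ a s → 1/[ a ]! ℚ.* s) 1ℚ r
  ℚ.* (B (suc (Vec.sum r)) ℚ.* (+ 1 ℚ./ suc (Vec.sum r)))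
  ℚ.* summand ks ν

module Submission where

-- Let h = x + 1/z, the holomorphic part of x, and read a word as a nested
-- expression: d differentiates, and y multiplies by h (giving ψ) or by -1/z
-- (giving χ). Since x = -1/z + h and d obeys the Leibniz rule, φ = χ ⋆ ψ
-- already on words. The values of ψ lie in 𝒜₊ and those of χ on nonempty words
-- in 𝒜₋, so by induction on the length of the word ψ agrees with φ₊ in every
-- Birkhoff decomposition. Hence ζ(-k₁, …, -kₙ) is the value at 0 of
-- ∂^{kₙ}(h ⋯ ∂^{k₁}(h)), and by Taylor's formula the generating function is
-- ∏ᵢ h(-(tᵢ + ⋯ + tₙ)). Finally h(-u) = 1/(eᵘ - 1) - 1/u.

open import Defs
open import Data.Bool using (Bool; true; false; _∧_; if_then_else_)
open import Data.Bool.Properties using (T?)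
open import Data.Empty using (⊥-elim)
open import Data.Fin as Fin using (Fin; zero; suc)
import Data.Integer as ℤ
import Data.Integer.Properties as ℤ
open import Data.Integer.Solver using () renaming (module +-*-Solver to ℤS)
open import Data.List
  using (List; []; _∷_; [_]; _++_; map; length; replicate; concatMap; cartesianProductWith;
         upTo; allFin; tabulate; filter; filterᵇ)
import Data.List.Properties as List
open import Data.List.Relation.Unary.All as All using (All; []; _∷_)
import Data.List.Relation.Unary.All.Properties as All
open import Data.Nat as ℕ using (ℕ; zero; suc; _∸_; _≤_; _≥_; z≤n; s≤s; _!)
import Data.Nat.Properties as ℕ
open import Data.Product using (∃; _×_; _,_; proj₁; proj₂)
open import Data.Rational using (ℚ; 0ℚ; 1ℚ; _+_; _*_; -_; _-_; _/_; toℚᵘ)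
open import Data.Rational.Properties
open import Data.Rational.Solver using (module +-*-Solver)
import Data.Rational.Unnormalised as ℚᵘ
import Data.Rational.Unnormalised.Properties as ℚᵘ
open import Data.Vec as Vec using (Vec; []; _∷_; sum)
open import Function using (_∘_)
open import Relation.Binary.PropositionalEquality hiding (J; [_])
open import Relation.Nullary using (does; yes; no)
open import Relation.Unary using (Decidable)
open +-*-Solver
open ≡-Reasoning

-- Both letters act through rules that split along a product: `d` by the Leibniz rule, and `y`
-- because the two summands of x = -1/z + h can be given to different factors. A subset in the
-- coproduct therefore records which letters act on the polar factor, and `χ` plays the part of
-- `φ₋⁻¹`, not of `φ₋`. The partial sums tᵢ + ⋯ + tₙ come from the nesting. The innermost block
-- belongs to k₁, and taking the coefficient of t₁^{k₁} in a function of t₁ + ⋯ + tₙ leaves a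
-- function of t₂ + ⋯ + tₙ, which the next block multiplies by a new factor. So the factor
-- introduced by block i is seen exactly by the variables tᵢ, ..., tₙ. The sign (-1)^{k₁ + ⋯ + kₙ}
-- arises because h is a series c in -z, so that every derivative contributes -1; the coefficients
-- of c are B_{m+1} / (m+1)!.

private variable
  J J′ J″ : Set
  n : ℕ
  f f′ g g′ : Series
  ρ ρ′ σ σ′ : MSeries n

-- Finite sums and Cauchy sums

∑-cong : ∀ (xs : List J) {f g : J → ℚ} → f ≗ g → ∑ xs f ≡ ∑ xs g
∑-cong []       f≗g = refl
∑-cong (i ∷ xs) f≗g = cong₂ _+_ (f≗g i) (∑-cong xs f≗g)

∑-cong-All : ∀ {xs : List J} {f g : J → ℚ} → All (λ i → f i ≡ g i) xs → ∑ xs f ≡ ∑ xs g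
∑-cong-All []       = refl
∑-cong-All (e ∷ es) = cong₂ _+_ e (∑-cong-All es)

∑-0 : ∀ (xs : List J) → ∑ xs (λ _ → 0ℚ) ≡ 0ℚ
∑-0 []       = refl
∑-0 (i ∷ xs) = trans (+-identityˡ _) (∑-0 xs)

∑-+ : ∀ (xs : List J) (f g : J → ℚ) → ∑ xs (λ i → f i + g i) ≡ ∑ xs f + ∑ xs g
∑-+ []       f g = refl
∑-+ (i ∷ xs) f g = trans (cong (f i + g i +_) (∑-+ xs f g))
  (solve 4 (λ a b c e → a :+ b :+ (c :+ e) := a :+ c :+ (b :+ e)) refl (f i) (g i) (∑ xs f) (∑ xs g))

∑-*ˡ : ∀ (xs : List J) c (f : J → ℚ) → ∑ xs (λ i → c * f i) ≡ c * ∑ xs f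
∑-*ˡ []       c f = sym (*-zeroʳ c)
∑-*ˡ (i ∷ xs) c f = trans (cong (c * f i +_) (∑-*ˡ xs c f)) (sym (*-distribˡ-+ c (f i) (∑ xs f)))

∑-++ : ∀ (xs ys : List J) (f : J → ℚ) → ∑ (xs ++ ys) f ≡ ∑ xs f + ∑ ys f
∑-++ []       ys f = sym (+-identityˡ _)
∑-++ (i ∷ xs) ys f = trans (cong (f i +_) (∑-++ xs ys f)) (sym (+-assoc (f i) _ _))

∑-map : ∀ (h : J → J′) xs (f : J′ → ℚ) → ∑ (map h xs) f ≡ ∑ xs (λ i → f (h i))
∑-map h []       f = refl
∑-map h (i ∷ xs) f = cong (f (h i) +_) (∑-map h xs f)

∑-concatMap : ∀ (h : J → List J′) xs (f : J′ → ℚ) → ∑ (concatMap h xs) f ≡ ∑ xs (λ i → ∑ (h i) f)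
∑-concatMap h []       f = refl
∑-concatMap h (i ∷ xs) f = trans (∑-++ (h i) _ f) (cong (∑ (h i) f +_) (∑-concatMap h xs f))

∑-cartesianProductWith : ∀ (h : J → J′ → J″) xs ys (f : J″ → ℚ) →
  ∑ (cartesianProductWith h xs ys) f ≡ ∑ xs (λ i → ∑ ys (λ j → f (h i j)))
∑-cartesianProductWith h []       ys f = refl
∑-cartesianProductWith h (i ∷ xs) ys f = trans (∑-++ (map (h i) ys) _ f)
  (cong₂ _+_ (∑-map (h i) ys f) (∑-cartesianProductWith h xs ys f))

∑-upTo-suc : ∀ n (f : ℕ → ℚ) → ∑ (upTo (suc n)) f ≡ f 0 + ∑ (upTo n) (λ k → f (suc k))
∑-upTo-suc n f = cong (f 0 +_) (trans (cong (λ xs → ∑ xs f) (sym (List.map-upTo suc n))) (∑-map suc (upTo n) f))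

∑-upTo-last : ∀ n (f : ℕ → ℚ) → ∑ (upTo (suc n)) f ≡ ∑ (upTo n) f + f n
∑-upTo-last n f = trans (cong (λ xs → ∑ xs f) (sym (List.upTo-∷ʳ n)))
  (trans (∑-++ (upTo n) _ f) (cong (∑ (upTo n) f +_) (+-identityʳ (f n))))

-- Σ_{a+b=n} W a b; opaque, since W can be inferred only as long as conv does
-- not unfold.
opaque
  conv : ℕ → (ℕ → ℕ → ℚ) → ℚ
  conv zero    W = W 0 0
  conv (suc n) W = W 0 (suc n) + conv n (λ a b → W (suc a) b)

  conv-zero : ∀ W → conv 0 W ≡ W 0 0
  conv-zero W = refl

  conv-suc : ∀ n W → conv (suc n) W ≡ W 0 (suc n) + conv n (λ a b → W (suc a) b)
  conv-suc n W = refl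

  ∑≡conv : ∀ n W → ∑ (upTo (suc n)) (λ a → W a (n ∸ a)) ≡ conv n W
  ∑≡conv zero    W = +-identityʳ (W 0 0)
  ∑≡conv (suc n) W = trans (∑-upTo-suc (suc n) (λ a → W a (suc n ∸ a)))
    (cong (W 0 (suc n) +_) (∑≡conv n (λ a b → W (suc a) b)))

  conv-cong : ∀ n {V W} → (∀ a b → a ℕ.+ b ≡ n → V a b ≡ W a b) → conv n V ≡ conv n W
  conv-cong zero    eq = eq 0 0 refl
  conv-cong (suc n) eq = cong₂ _+_ (eq 0 (suc n) refl)
    (conv-cong n (λ a b e → eq (suc a) b (cong suc e)))

  conv-0 : ∀ n → conv n (λ _ _ → 0ℚ) ≡ 0ℚ
  conv-0 zero    = refl
  conv-0 (suc n) = trans (+-identityˡ _) (conv-0 n)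

  conv-+ : ∀ n V W → conv n (λ a b → V a b + W a b) ≡ conv n V + conv n W
  conv-+ zero    V W = refl
  conv-+ (suc n) V W = trans (cong (V 0 (suc n) + W 0 (suc n) +_) (conv-+ n _ _))
    (solve 4 (λ a b c e → a :+ b :+ (c :+ e) := a :+ c :+ (b :+ e)) refl (V 0 (suc n)) (W 0 (suc n)) _ _)

  conv-*ˡ : ∀ n c W → conv n (λ a b → c * W a b) ≡ c * conv n W
  conv-*ˡ zero    c W = refl
  conv-*ˡ (suc n) c W = trans (cong (c * W 0 (suc n) +_) (conv-*ˡ n c _)) (sym (*-distribˡ-+ c (W 0 (suc n)) _))

conv-cong′ : ∀ n {V W} → (∀ a b → V a b ≡ W a b) → conv n V ≡ conv n W
conv-cong′ n eq = conv-cong n (λ a b _ → eq a b)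

conv-*ʳ : ∀ n c W → conv n (λ a b → W a b * c) ≡ conv n W * c
conv-*ʳ n c W = trans (conv-cong′ n (λ a b → *-comm (W a b) c)) (trans (conv-*ˡ n c W) (*-comm c _))

conv-∑ : ∀ n (xs : List J) (W : J → ℕ → ℕ → ℚ) →
         conv n (λ a b → ∑ xs λ i → W i a b) ≡ ∑ xs (λ i → conv n (W i))
conv-∑ n []       W = conv-0 n
conv-∑ n (i ∷ xs) W = trans (conv-+ n (W i) _) (cong (conv n (W i) +_) (conv-∑ n xs W))

-- The mirror image of the recursion of `conv`; symmetry and the Leibniz rule need both ends of the
-- sum.
conv-sucʳ : ∀ n W → conv (suc n) W ≡ conv n (λ a b → W a (suc b)) + W (suc n) 0
conv-sucʳ zero    W = trans (conv-suc 0 W) (cong₂ _+_ (sym (conv-zero (λ a b → W a (suc b)))) (conv-zero _))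
conv-sucʳ (suc n) W = begin
  conv (suc (suc n)) W                                                    ≡⟨ conv-suc (suc n) W ⟩
  W 0 (suc (suc n)) + conv (suc n) (λ a b → W (suc a) b)                   ≡⟨ cong (W 0 (suc (suc n)) +_) (conv-sucʳ n _) ⟩
  W 0 (suc (suc n)) + (conv n (λ a b → W (suc a) (suc b)) + W (suc (suc n)) 0) ≡⟨ +-assoc (W 0 (suc (suc n))) _ _ ⟨
  W 0 (suc (suc n)) + conv n (λ a b → W (suc a) (suc b)) + W (suc (suc n)) 0 ≡⟨ cong (_+ W (suc (suc n)) 0) (conv-suc n _) ⟨
  conv (suc n) (λ a b → W a (suc b)) + W (suc (suc n)) 0                  ∎

conv-comm : ∀ n W → conv n W ≡ conv n (λ a b → W b a)
conv-comm zero    W = trans (conv-zero _) (sym (conv-zero _))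
conv-comm (suc n) W = begin
  conv (suc n) W                                  ≡⟨ conv-suc n W ⟩
  W 0 (suc n) + conv n (λ a b → W (suc a) b)      ≡⟨ +-comm (W 0 (suc n)) _ ⟩
  conv n (λ a b → W (suc a) b) + W 0 (suc n)      ≡⟨ cong (_+ W 0 (suc n)) (conv-comm n _) ⟩
  conv n (λ a b → W (suc b) a) + W 0 (suc n)      ≡⟨ conv-sucʳ n _ ⟨
  conv (suc n) (λ a b → W b a)                    ∎

-- Both sides run over i + j + b = n. The terms with i = 0 together form `conv (suc n) (W 0)`, and
-- the others fall under the induction hypothesis.
conv-assoc : ∀ n (W : ℕ → ℕ → ℕ → ℚ) →
  conv n (λ a b → conv a (λ i j → W i j b)) ≡ conv n (λ i m → conv m (W i))
conv-assoc zero    W = trans (conv-zero _) (trans (conv-zero _) (sym (trans (conv-zero _) (conv-zero _))))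
conv-assoc (suc n) W = begin
  conv (suc n) (λ a b → conv a (λ i j → W i j b))
    ≡⟨ conv-suc n _ ⟩
  conv 0 (λ i j → W i j (suc n)) + conv n (λ a b → conv (suc a) (λ i j → W i j b))
    ≡⟨ cong₂ _+_ (conv-zero _) (conv-cong′ n (λ a b → conv-suc a _)) ⟩
  W 0 0 (suc n) + conv n (λ a b → W 0 (suc a) b + conv a (λ i j → W (suc i) j b))
    ≡⟨ cong (W 0 0 (suc n) +_) (conv-+ n _ _) ⟩
  W 0 0 (suc n) + (conv n (λ a b → W 0 (suc a) b) + conv n (λ a b → conv a (λ i j → W (suc i) j b)))
    ≡⟨ +-assoc (W 0 0 (suc n)) _ _ ⟨
  W 0 0 (suc n) + conv n (λ a b → W 0 (suc a) b) + conv n (λ a b → conv a (λ i j → W (suc i) j b))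
    ≡⟨ cong₂ _+_ (sym (conv-suc n (W 0))) (conv-assoc n (λ i → W (suc i))) ⟩
  conv (suc n) (W 0) + conv n (λ i m → conv m (W (suc i)))
    ≡⟨ conv-suc n _ ⟨
  conv (suc n) (λ i m → conv m (W i)) ∎

-- Integers and factorials in the rationals

toℚᵘ-fromℤ : ∀ i → toℚᵘ (fromℤ i) ℚᵘ.≃ ℚᵘ.mkℚᵘ i 0
toℚᵘ-fromℤ i = toℚᵘ-fromℚᵘ (ℚᵘ.mkℚᵘ i 0)

fromℤ-+ : ∀ i j → fromℤ (i ℤ.+ j) ≡ fromℤ i + fromℤ j
fromℤ-+ i j = toℚᵘ-injective (ℚᵘ.≃-trans (toℚᵘ-fromℤ (i ℤ.+ j)) (ℚᵘ.≃-trans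
  (ℚᵘ.*≡* (cong (ℤ._* ℤ.+ 1) (cong₂ ℤ._+_ (sym (ℤ.*-identityʳ i)) (sym (ℤ.*-identityʳ j)))))
  (ℚᵘ.≃-sym (ℚᵘ.≃-trans (toℚᵘ-homo-+ (fromℤ i) (fromℤ j)) (ℚᵘ.+-cong (toℚᵘ-fromℤ i) (toℚᵘ-fromℤ j))))))

fromℤ-* : ∀ i j → fromℤ (i ℤ.* j) ≡ fromℤ i * fromℤ j
fromℤ-* i j = toℚᵘ-injective (ℚᵘ.≃-trans (toℚᵘ-fromℤ (i ℤ.* j)) (ℚᵘ.≃-trans
  (ℚᵘ.*≡* refl)
  (ℚᵘ.≃-sym (ℚᵘ.≃-trans (toℚᵘ-homo-* (fromℤ i) (fromℤ j)) (ℚᵘ.*-cong (toℚᵘ-fromℤ i) (toℚᵘ-fromℤ j))))))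

fromℕ-+ : ∀ m n → fromℕ (m ℕ.+ n) ≡ fromℕ m + fromℕ n
fromℕ-+ m n = fromℤ-+ (ℤ.+ m) (ℤ.+ n)

fromℕ-* : ∀ m n → fromℕ (m ℕ.* n) ≡ fromℕ m * fromℕ n
fromℕ-* m n = trans (cong fromℤ (ℤ.pos-* m n)) (fromℤ-* (ℤ.+ m) (ℤ.+ n))

1/n*n≡1 : ∀ n .{{_ : ℕ.NonZero n}} → (ℤ.+ 1 / n) * fromℕ n ≡ 1ℚ
1/n*n≡1 (suc n) = toℚᵘ-injective (ℚᵘ.≃-trans (toℚᵘ-homo-* (ℤ.+ 1 / suc n) (fromℕ (suc n)))
  (ℚᵘ.≃-trans (ℚᵘ.*-cong (toℚᵘ-fromℚᵘ (ℚᵘ.mkℚᵘ (ℤ.+ 1) n)) (toℚᵘ-fromℤ (ℤ.+ suc n)))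
    (ℚᵘ.*≡* (cong (λ m → ℤ.+ suc m) (trans (ℕ.*-identityʳ _) (trans (ℕ.+-identityʳ n) (sym
      (trans (ℕ.+-identityʳ _) (ℕ.*-identityʳ n)))))))))

fromℕ-cancel : ∀ n {p q} → fromℕ (suc n) * p ≡ fromℕ (suc n) * q → p ≡ q
fromℕ-cancel n {p} {q} eq = trans (sym (lemma p)) (trans (cong ((ℤ.+ 1 / suc n) *_) eq) (lemma q))
  where
  lemma : ∀ p → (ℤ.+ 1 / suc n) * (fromℕ (suc n) * p) ≡ p
  lemma p = trans (sym (*-assoc (ℤ.+ 1 / suc n) (fromℕ (suc n)) p)) (trans (cong (_* p) (1/n*n≡1 (suc n))) (*-identityˡ p))

1/n!*n!≡1 : ∀ n → 1/[ n ]! * fromℕ (n !) ≡ 1ℚ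
1/n!*n!≡1 n = 1/n*n≡1 (n !) {{n ℕ.!≢0}}

!-suc : ∀ n → fromℕ (suc n !) ≡ fromℕ (suc n) * fromℕ (n !)
!-suc n = fromℕ-* (suc n) (n !)

1/!-suc : ∀ n → fromℕ (suc n) * 1/[ suc n ]! ≡ 1/[ n ]!
1/!-suc n = begin
  s * a′                   ≡⟨ *-identityʳ (s * a′) ⟨
  s * a′ * 1ℚ              ≡⟨ cong (s * a′ *_) (1/n!*n!≡1 n) ⟨
  s * a′ * (a * b)         ≡⟨ solve 4 (λ s a a′ b → s :* a′ :* (a :* b) := a :* (a′ :* (s :* b))) refl s a a′ b ⟩
  a * (a′ * (s * b))       ≡⟨ cong (λ c → a * (a′ * c)) (!-suc n) ⟨
  a * (a′ * fromℕ (suc n !)) ≡⟨ cong (a *_) (1/n!*n!≡1 (suc n)) ⟩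
  a * 1ℚ                   ≡⟨ *-identityʳ a ⟩
  a                        ∎
  where
  s = fromℕ (suc n)
  a = 1/[ n ]!
  a′ = 1/[ suc n ]!
  b = fromℕ (n !)

-- Writing n + 1 as a + b splits the sum in two, and in each half the end term of weight 0 drops
-- out. With an arbitrary W this serves the Leibniz rules of both `δ` and `𝔇`.
conv-deriv : ∀ n W → fromℕ (suc n) * conv (suc n) W ≡
  conv n (λ a b → fromℕ (suc a) * W (suc a) b) + conv n (λ a b → fromℕ (suc b) * W a (suc b))
conv-deriv n W = begin
  fromℕ (suc n) * conv (suc n) W
    ≡⟨ conv-*ˡ (suc n) (fromℕ (suc n)) W ⟨
  conv (suc n) (λ a b → fromℕ (suc n) * W a b)
    ≡⟨ conv-cong (suc n) (λ a b a+b≡n → trans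
         (cong (_* W a b) (trans (cong fromℕ (sym a+b≡n)) (fromℕ-+ a b)))
         (*-distribʳ-+ (W a b) (fromℕ a) (fromℕ b))) ⟩
  conv (suc n) (λ a b → fromℕ a * W a b + fromℕ b * W a b)
    ≡⟨ conv-+ (suc n) _ _ ⟩
  conv (suc n) (λ a b → fromℕ a * W a b) + conv (suc n) (λ a b → fromℕ b * W a b)
    ≡⟨ cong₂ _+_ (conv-suc n _) (conv-sucʳ n _) ⟩
  0ℚ * W 0 (suc n) + conv n (λ a b → fromℕ (suc a) * W (suc a) b) +
  (conv n (λ a b → fromℕ (suc b) * W a (suc b)) + 0ℚ * W (suc n) 0)
    ≡⟨ solve 4 (λ a b p q → con 0ℚ :* a :+ p :+ (q :+ con 0ℚ :* b) := p :+ q) refl (W 0 (suc n)) (W (suc n) 0) (conv n (λ a b → fromℕ (suc a) * W (suc a) b)) _ ⟩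
  conv n (λ a b → fromℕ (suc a) * W (suc a) b) + conv n (λ a b → fromℕ (suc b) * W a (suc b)) ∎

-- Power series in one variable

⊛≡conv : ∀ f g n → (f ⊛ g) n ≡ conv n (λ a b → f a * g b)
⊛≡conv f g n = ∑≡conv n (λ a b → f a * g b)

⊛-zero : ∀ f g → (f ⊛ g) 0 ≡ f 0 * g 0
⊛-zero f g = +-identityʳ _

⊛-suc : ∀ f g n → (f ⊛ g) (suc n) ≡ f 0 * g (suc n) + (divZ f ⊛ g) n
⊛-suc f g n = trans (⊛≡conv f g (suc n)) (trans (conv-suc n _)
  (cong ((f 0 * g (suc n)) +_) (sym (⊛≡conv (divZ f) g n))))

-- Coefficient n of a product sees the factors only up to order n; `pow-order` knows its second
-- factor only in such a range.
⊛-cong< : ∀ n → (∀ a → a ≤ n → f a ≡ f′ a) → (∀ b → b ≤ n → g b ≡ g′ b) → (f ⊛ g) n ≡ (f′ ⊛ g′) n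
⊛-cong< {f} {f′} {g} {g′} n f≡f′ g≡g′ = trans (⊛≡conv f g n) (trans
  (conv-cong n (λ a b a+b≡n → cong₂ _*_ (f≡f′ a (ℕ.m+n≤o⇒m≤o a (ℕ.≤-reflexive a+b≡n)))
                                        (g≡g′ b (ℕ.m+n≤o⇒n≤o a (ℕ.≤-reflexive a+b≡n)))))
  (sym (⊛≡conv f′ g′ n)))

⊛-cong : f ≗ f′ → g ≗ g′ → f ⊛ g ≗ f′ ⊛ g′
⊛-cong f≗f′ g≗g′ n = ⊛-cong< n (λ a _ → f≗f′ a) (λ b _ → g≗g′ b)

⊛-congˡ : ∀ g → f ≗ f′ → f ⊛ g ≗ f′ ⊛ g
⊛-congˡ g f≗f′ = ⊛-cong {g = g} f≗f′ (λ _ → refl)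

⊛-congʳ : ∀ f → g ≗ g′ → f ⊛ g ≗ f ⊛ g′
⊛-congʳ f g≗g′ = ⊛-cong {f = f} (λ _ → refl) g≗g′

⊛-comm : ∀ f g → f ⊛ g ≗ g ⊛ f
⊛-comm f g n = trans (⊛≡conv f g n) (trans (conv-comm n _) (trans
  (conv-cong′ n (λ a b → *-comm (f b) (g a))) (sym (⊛≡conv g f n))))

⊛-assoc : ∀ f g h → f ⊛ g ⊛ h ≗ f ⊛ (g ⊛ h)
⊛-assoc f g h n = begin
  (f ⊛ g ⊛ h) n
    ≡⟨ ⊛≡conv (f ⊛ g) h n ⟩
  conv n (λ a b → (f ⊛ g) a * h b)
    ≡⟨ conv-cong′ n (λ a b → trans (cong (_* h b) (⊛≡conv f g a)) (sym (conv-*ʳ a (h b) _))) ⟩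
  conv n (λ a b → conv a (λ i j → f i * g j * h b))
    ≡⟨ conv-assoc n _ ⟩
  conv n (λ i m → conv m (λ j b → f i * g j * h b))
    ≡⟨ conv-cong′ n (λ i m → trans (conv-cong′ m (λ j b → *-assoc (f i) (g j) (h b)))
         (trans (conv-*ˡ m (f i) _) (cong (f i *_) (sym (⊛≡conv g h m))))) ⟩
  conv n (λ i m → f i * (g ⊛ h) m)
    ≡⟨ ⊛≡conv f (g ⊛ h) n ⟨
  (f ⊛ (g ⊛ h)) n ∎

⊛-distribʳ-⊕ : ∀ f g h → (g ⊕ h) ⊛ f ≗ g ⊛ f ⊕ h ⊛ f
⊛-distribʳ-⊕ f g h n = trans (⊛≡conv (g ⊕ h) f n) (trans
  (conv-cong′ n (λ a b → *-distribʳ-+ (f b) (g a) (h a))) (trans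
  (conv-+ n _ _) (cong₂ _+_ (sym (⊛≡conv g f n)) (sym (⊛≡conv h f n)))))

⊛-distribˡ-⊕ : ∀ f g h → f ⊛ (g ⊕ h) ≗ f ⊛ g ⊕ f ⊛ h
⊛-distribˡ-⊕ f g h n = trans (⊛-comm f (g ⊕ h) n) (trans (⊛-distribʳ-⊕ f g h n)
  (cong₂ _+_ (⊛-comm g f n) (⊛-comm h f n)))

⊛-scaleˡ : ∀ c f g → (λ n → c * f n) ⊛ g ≗ (λ n → c * (f ⊛ g) n)
⊛-scaleˡ c f g n = trans (⊛≡conv (λ n → c * f n) g n) (trans
  (conv-cong′ n (λ a b → *-assoc c (f a) (g b))) (trans (conv-*ˡ n c _) (cong (c *_) (sym (⊛≡conv f g n)))))

⊛-scaleʳ : ∀ c f g → f ⊛ (λ n → c * g n) ≗ (λ n → c * (f ⊛ g) n)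
⊛-scaleʳ c f g n = trans (⊛-comm f (λ n → c * g n) n) (trans (⊛-scaleˡ c g f n) (cong (c *_) (⊛-comm g f n)))

-p≡-1*p : ∀ p → - p ≡ - 1ℚ * p
-p≡-1*p = solve 1 (λ p → :- p := con (- 1ℚ) :* p) refl

⊛-negˡ : ∀ f g → (λ n → - f n) ⊛ g ≗ (λ n → - (f ⊛ g) n)
⊛-negˡ f g n = trans (⊛-congˡ g (λ a → -p≡-1*p (f a)) n)
  (trans (⊛-scaleˡ (- 1ℚ) f g n) (sym (-p≡-1*p ((f ⊛ g) n))))

⊛-zeroˡ : ∀ g → f ≗ (λ _ → 0ℚ) → f ⊛ g ≗ (λ _ → 0ℚ)
⊛-zeroˡ {f} g f≗0 n = trans (⊛≡conv f g n) (trans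
  (conv-cong′ n (λ a b → trans (cong (_* g b) (f≗0 a)) (*-zeroˡ (g b)))) (conv-0 n))

⊛-zeroʳ : ∀ f → g ≗ (λ _ → 0ℚ) → f ⊛ g ≗ (λ _ → 0ℚ)
⊛-zeroʳ {g} f g≗0 n = trans (⊛-comm f g n) (⊛-zeroˡ f g≗0 n)

⊛-identityˡ : ∀ f → const 1ℚ ⊛ f ≗ f
⊛-identityˡ f zero    = trans (⊛-zero (const 1ℚ) f) (*-identityˡ (f 0))
⊛-identityˡ f (suc n) = trans (⊛-suc (const 1ℚ) f n) (trans
  (cong₂ _+_ (*-identityˡ (f (suc n))) (⊛-zeroˡ {divZ (const 1ℚ)} f (λ _ → refl) n)) (+-identityʳ (f (suc n))))

⊛-identityʳ : ∀ f → f ⊛ const 1ℚ ≗ f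
⊛-identityʳ f n = trans (⊛-comm f (const 1ℚ) n) (⊛-identityˡ f n)

mulZ-cong : f ≗ g → mulZ f ≗ mulZ g
mulZ-cong f≗g zero    = refl
mulZ-cong f≗g (suc n) = f≗g n

mulZ-⊛ : ∀ f g → mulZ f ⊛ g ≗ mulZ (f ⊛ g)
mulZ-⊛ f g zero    = trans (⊛-zero (mulZ f) g) (*-zeroˡ (g 0))
mulZ-⊛ f g (suc n) = trans (⊛-suc (mulZ f) g n) (trans (cong (_+ (f ⊛ g) n) (*-zeroˡ (g (suc n)))) (+-identityˡ _))

⊛-mulZ : ∀ f g → f ⊛ mulZ g ≗ mulZ (f ⊛ g)
⊛-mulZ f g n = trans (⊛-comm f (mulZ g) n) (trans (mulZ-⊛ g f n) (mulZ-cong (⊛-comm g f) n))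

mulZ-divZ : f 0 ≡ 0ℚ → mulZ (divZ f) ≗ f
mulZ-divZ f0≡0 zero    = sym f0≡0
mulZ-divZ f0≡0 (suc n) = refl

divZ-⊛ : ∀ f g → f 0 ≡ 0ℚ → divZ (f ⊛ g) ≗ divZ f ⊛ g
divZ-⊛ f g f0≡0 n = trans (⊛-congˡ g (λ k → sym (mulZ-divZ {f} f0≡0 k)) (suc n)) (mulZ-⊛ (divZ f) g (suc n))

δ : Series → Series
δ f n = fromℕ (suc n) * f (suc n)

δ-cong : f ≗ g → δ f ≗ δ g
δ-cong f≗g n = cong (fromℕ (suc n) *_) (f≗g (suc n))

δ-⊛ : ∀ f g → δ (f ⊛ g) ≗ δ f ⊛ g ⊕ f ⊛ δ g
δ-⊛ f g n = trans (cong (fromℕ (suc n) *_) (⊛≡conv f g (suc n))) (trans (conv-deriv n _) (cong₂ _+_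
  (trans (conv-cong′ n (λ a b → sym (*-assoc (fromℕ (suc a)) (f (suc a)) (g b)))) (sym (⊛≡conv (δ f) g n)))
  (trans (conv-cong′ n (λ a b → solve 3 (λ c p q → c :* (p :* q) := p :* (c :* q)) refl (fromℕ (suc b)) (f a) (g (suc b))))
    (sym (⊛≡conv f (δ g) n)))))

-- Powers and geometric inverses of series

pow-order : ∀ f → f 0 ≡ 0ℚ → ∀ {m n} → n ℕ.< m → pow f m n ≡ 0ℚ
pow-order f f0 {suc m} {zero}  _         = trans (⊛-zero f (pow f m)) (trans (cong (_* pow f m 0) f0) (*-zeroˡ (pow f m 0)))
pow-order f f0 {suc m} {suc n} (s≤s n<m) = trans (divZ-⊛ f (pow f m) f0 n) (trans
  (⊛-cong< {f = divZ f} {g′ = λ _ → 0ℚ} n (λ _ _ → refl) (λ b b≤n → pow-order f f0 (ℕ.≤-<-trans b≤n n<m)))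
  (⊛-zeroʳ (divZ f) (λ _ → refl) n))

∑-upTo-extend : ∀ m n {F : ℕ → ℚ} → (∀ {j} → m ≤ j → F j ≡ 0ℚ) → ∑ (upTo (n ℕ.+ m)) F ≡ ∑ (upTo m) F
∑-upTo-extend m zero    F≡0 = refl
∑-upTo-extend m (suc n) {F} F≡0 = trans (∑-upTo-last (n ℕ.+ m) F) (trans
  (cong₂ _+_ (∑-upTo-extend m n {F} F≡0) (F≡0 (ℕ.m≤n+m m n))) (+-identityʳ _))

-- With u = 1 - f the geometric series satisfies inv f = 1 + u · inv f. The difficulty is that the
-- truncation of the series depends on the coefficient considered, so the truncations have to be
-- matched.
inv-suc : ∀ f → f 0 ≡ 1ℚ → ∀ n → inv f (suc n) ≡ (divZ (const 1ℚ ⊖ f) ⊛ inv f) n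
inv-suc f f0 n = begin
  inv f (suc n)
    ≡⟨ ∑-upTo-suc (suc n) (λ j → pow u j (suc n)) ⟩
  0ℚ + ∑ (upTo (suc n)) (λ j → (u ⊛ pow u j) (suc n))
    ≡⟨ +-identityˡ (∑ (upTo (suc n)) (λ j → (u ⊛ pow u j) (suc n))) ⟩
  ∑ (upTo (suc n)) (λ j → (u ⊛ pow u j) (suc n))
    ≡⟨ ∑-cong (upTo (suc n)) {λ j → (u ⊛ pow u j) (suc n)} (λ j → trans (divZ-⊛ u (pow u j) u0 n) (⊛≡conv (divZ u) (pow u j) n)) ⟩
  ∑ (upTo (suc n)) (λ j → conv n (λ a b → divZ u a * pow u j b))
    ≡⟨ conv-∑ n (upTo (suc n)) (λ j a b → divZ u a * pow u j b) ⟨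
  conv n (λ a b → ∑ (upTo (suc n)) (λ j → divZ u a * pow u j b))
    -- For the coefficient b ≤ n the powers j > b vanish, so the sum up to n equals the one up to b
    -- in the definition of `inv f b`.
    ≡⟨ conv-cong n (λ a b a+b≡n → trans (∑-*ˡ (upTo (suc n)) (divZ u a) (λ j → pow u j b)) (cong (divZ u a *_)
         (trans (cong (λ m → ∑ (upTo m) (λ j → pow u j b)) (trans (cong suc (sym a+b≡n)) (sym (ℕ.+-suc a b))))
           (∑-upTo-extend (suc b) a {λ j → pow u j b} (pow-order u u0))))) ⟩
  conv n (λ a b → divZ u a * inv f b)
    ≡⟨ ⊛≡conv (divZ u) (inv f) n ⟨
  (divZ u ⊛ inv f) n ∎
  where
  u = const 1ℚ ⊖ f
  u0 : u 0 ≡ 0ℚ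
  u0 = cong (_-_ 1ℚ) f0

-- By `inv-suc` the two parts of a positive coefficient cancel, since 1 - f and f have opposite
-- coefficients beyond the constant term.
⊛-inv : ∀ f → f 0 ≡ 1ℚ → f ⊛ inv f ≗ const 1ℚ
⊛-inv f f0 zero = trans (⊛-zero f (inv f)) (cong (_* inv f 0) f0)
⊛-inv f f0 (suc n) = begin
  (f ⊛ inv f) (suc n)
    ≡⟨ ⊛-suc f (inv f) n ⟩
  f 0 * inv f (suc n) + (divZ f ⊛ inv f) n
    ≡⟨ cong (_+ (divZ f ⊛ inv f) n) (trans (cong₂ _*_ f0 (inv-suc f f0 n)) (*-identityˡ ((divZ (const 1ℚ ⊖ f) ⊛ inv f) n))) ⟩
  (divZ (const 1ℚ ⊖ f) ⊛ inv f) n + (divZ f ⊛ inv f) n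
    ≡⟨ ⊛-distribʳ-⊕ (inv f) (divZ (const 1ℚ ⊖ f)) (divZ f) n ⟨
  ((divZ (const 1ℚ ⊖ f) ⊕ divZ f) ⊛ inv f) n
    ≡⟨ ⊛-zeroˡ {divZ (const 1ℚ ⊖ f) ⊕ divZ f} (inv f) (λ k → solve 1 (λ a → con 0ℚ :+ (:- a) :+ a := con 0ℚ) refl (f (suc k))) n ⟩
  0ℚ ∎

-- f (-z)
sg : Series → Series
sg f n = -1^ n * f n

-1^-+ : ∀ m n → -1^ (m ℕ.+ n) ≡ -1^ m * -1^ n
-1^-+ zero    n = sym (*-identityˡ (-1^ n))
-1^-+ (suc m) n = trans (cong -_ (-1^-+ m n)) (neg-distribˡ-* (-1^ m) (-1^ n))

-1^-square : ∀ n → -1^ n * -1^ n ≡ 1ℚ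
-1^-square zero    = refl
-1^-square (suc n) = trans (solve 1 (λ a → (:- a) :* (:- a) := a :* a) refl (-1^ n)) (-1^-square n)

sg-cong : f ≗ g → sg f ≗ sg g
sg-cong f≗g n = cong (-1^ n *_) (f≗g n)

sg-⊛ : ∀ f g → sg (f ⊛ g) ≗ sg f ⊛ sg g
sg-⊛ f g n = begin
  -1^ n * (f ⊛ g) n                                  ≡⟨ cong (-1^ n *_) (⊛≡conv f g n) ⟩
  -1^ n * conv n (λ a b → f a * g b)                 ≡⟨ conv-*ˡ n (-1^ n) _ ⟨
  conv n (λ a b → -1^ n * (f a * g b))               ≡⟨ conv-cong n (λ a b a+b≡n → trans
    (cong (_* (f a * g b)) (trans (cong -1^ (sym a+b≡n)) (-1^-+ a b)))
    (solve 4 (λ p q r s → p :* q :* (r :* s) := p :* r :* (q :* s)) refl (-1^ a) (-1^ b) (f a) (g b))) ⟩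
  conv n (λ a b → sg f a * sg g b)                   ≡⟨ ⊛≡conv (sg f) (sg g) n ⟨
  (sg f ⊛ sg g) n                                    ∎

δ-sg : ∀ f → δ (sg f) ≗ (λ n → - sg (δ f) n)
δ-sg f n = solve 3 (λ s e p → s :* ((:- e) :* p) := :- (e :* (s :* p))) refl (fromℕ (suc n)) (-1^ n) (f (suc n))

-- The exponential series and the generating function of the Bernoulli numbers

δ-exp : δ exp ≗ exp
δ-exp = 1/!-suc

sg-exp-⊛-exp : sg exp ⊛ exp ≗ const 1ℚ
sg-exp-⊛-exp zero    = refl
sg-exp-⊛-exp (suc n) = fromℕ-cancel n (begin
  δ (sg exp ⊛ exp) n
    ≡⟨ δ-⊛ (sg exp) exp n ⟩
  (δ (sg exp) ⊛ exp) n + (sg exp ⊛ δ exp) n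
    ≡⟨ cong₂ _+_
         (trans (⊛-congˡ exp (λ k → trans (δ-sg exp k) (cong -_ (sg-cong δ-exp k))) n) (⊛-negˡ (sg exp) exp n))
         (⊛-congʳ (sg exp) δ-exp n) ⟩
  - (sg exp ⊛ exp) n + (sg exp ⊛ exp) n
    ≡⟨ +-inverseˡ ((sg exp ⊛ exp) n) ⟩
  0ℚ
    ≡⟨ *-zeroʳ (fromℕ (suc n)) ⟨
  fromℕ (suc n) * 0ℚ ∎)

-- I = u / (eᵘ - 1) and c = 1 / (eᵘ - 1) - 1 / u.
expm1/z I c : Series
expm1/z = divZ expm1
I = inv expm1/z
c = divZ I

sg-expm1/z-⊛-exp : sg expm1/z ⊛ exp ≗ expm1/z
sg-expm1/z-⊛-exp n = begin
  p                       ≡⟨ solve 2 (λ p q → p := q :+ con 0ℚ :- (:- p :+ q)) refl p q ⟩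
  q - 0ℚ - (- p + q)      ≡⟨ cong (_-_ (q - 0ℚ)) eq ⟩
  q - 0ℚ - 0ℚ             ≡⟨ +-identityʳ (q - 0ℚ) ⟩
  expm1/z n               ∎
  where
  p = (sg expm1/z ⊛ exp) n
  q = exp (suc n)
  split : sg exp ≗ sg expm1 ⊕ const 1ℚ
  split zero    = refl
  split (suc k) = solve 2 (λ e q → e :* q := e :* (q :- con 0ℚ) :+ con 0ℚ) refl (-1^ (suc k)) (exp (suc k))
  eq : - p + q ≡ 0ℚ
  eq = begin
    - p + q
      ≡⟨ cong₂ _+_ (sym (trans (divZ-⊛ (sg expm1) exp refl n) (trans
           (⊛-congˡ exp (λ k → sym (neg-distribˡ-* (-1^ k) (expm1/z k))) n) (⊛-negˡ (sg expm1/z) exp n))))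
           (sym (⊛-identityˡ exp (suc n))) ⟩
    (sg expm1 ⊛ exp) (suc n) + (const 1ℚ ⊛ exp) (suc n)
      ≡⟨ ⊛-distribʳ-⊕ exp (sg expm1) (const 1ℚ) (suc n) ⟨
    ((sg expm1 ⊕ const 1ℚ) ⊛ exp) (suc n)
      ≡⟨ ⊛-congˡ exp split (suc n) ⟨
    (sg exp ⊛ exp) (suc n)
      ≡⟨ sg-exp-⊛-exp (suc n) ⟩
    0ℚ ∎

expm1/z-⊛-I : expm1/z ⊛ I ≗ const 1ℚ
expm1/z-⊛-I = ⊛-inv expm1/z refl

exp-⊛-I : exp ⊛ I ≗ sg I
exp-⊛-I n = begin
  (exp ⊛ I) n                          ≡⟨ ⊛-identityˡ (exp ⊛ I) n ⟨
  (const 1ℚ ⊛ (exp ⊛ I)) n             ≡⟨ ⊛-congˡ (exp ⊛ I) sgI-⊛ n ⟨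
  (sg I ⊛ sg expm1/z ⊛ (exp ⊛ I)) n    ≡⟨ ⊛-assoc (sg I) (sg expm1/z) (exp ⊛ I) n ⟩
  (sg I ⊛ (sg expm1/z ⊛ (exp ⊛ I))) n  ≡⟨ ⊛-congʳ (sg I) (λ k → trans (sym (⊛-assoc (sg expm1/z) exp I k)) (trans
                                            (⊛-congˡ I sg-expm1/z-⊛-exp k) (expm1/z-⊛-I k))) n ⟩
  (sg I ⊛ const 1ℚ) n                  ≡⟨ ⊛-identityʳ (sg I) n ⟩
  sg I n                               ∎
  where
  sg-1 : sg (const 1ℚ) ≗ const 1ℚ
  sg-1 zero    = refl
  sg-1 (suc k) = *-zeroʳ (-1^ (suc k))
  sgI-⊛ : sg I ⊛ sg expm1/z ≗ const 1ℚ
  sgI-⊛ k = trans (sym (sg-⊛ I expm1/z k)) (trans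
    (sg-cong (λ j → trans (⊛-comm I expm1/z j) (expm1/z-⊛-I j)) k) (sg-1 k))

-- The numerator of `factor` is (1 - (eᵘ - 1)/u)/u. Multiplied by I it becomes (I - 1)/u, because
-- (eᵘ - 1)/u · I = 1.
factor≗c : factor ≗ c
factor≗c n = begin
  factor n                    ≡⟨ ⊛-congˡ I divZ-u n ⟩
  (divZ u ⊛ I) n              ≡⟨ divZ-⊛ u I refl n ⟨
  (u ⊛ I) (suc n)             ≡⟨ +-identityʳ ((u ⊛ I) (suc n)) ⟨
  (u ⊛ I) (suc n) + 0ℚ        ≡⟨ cong (_+_ ((u ⊛ I) (suc n))) (expm1/z-⊛-I (suc n)) ⟨
  (u ⊛ I) (suc n) + (expm1/z ⊛ I) (suc n) ≡⟨ ⊛-distribʳ-⊕ I u expm1/z (suc n) ⟨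
  ((u ⊕ expm1/z) ⊛ I) (suc n) ≡⟨ ⊛-congˡ I (λ k → solve 2 (λ a b → a :- b :+ b := a) refl (const 1ℚ k) (expm1/z k)) (suc n) ⟩
  (const 1ℚ ⊛ I) (suc n)      ≡⟨ ⊛-identityˡ I (suc n) ⟩
  c n                         ∎
  where
  u = const 1ℚ ⊖ expm1/z
  divZ-u : divZ (divZ (X ⊖ expm1)) ≗ divZ u
  divZ-u k = refl

-- x + 1/z
h : Series
h = sg c

-- The left side is the numerator of `x`, so division by z gives x = -1/z + h.
-exp-⊛-I : (λ n → - (exp ⊛ I) n) ≗ const (- 1ℚ) ⊕ mulZ h
-exp-⊛-I zero    = refl
-exp-⊛-I (suc n) = trans (cong -_ (exp-⊛-I (suc n)))
  (solve 2 (λ a b → :- ((:- a) :* b) := con 0ℚ :+ a :* b) refl (-1^ n) (I (suc n)))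

-- 𝔇 k f = δᵏ f / k!, the coefficient of tᵏ in f (z + t).
𝔇 : ℕ → Series → Series
𝔇 k f n = fromℕ ((n ℕ.+ k) !) * (1/[ n ]! * 1/[ k ]!) * f (n ℕ.+ k)

𝔇-zero : ∀ f → 𝔇 0 f ≗ f
𝔇-zero f n = begin
  fromℕ ((n ℕ.+ 0) !) * (1/[ n ]! * 1ℚ) * f (n ℕ.+ 0)
    ≡⟨ cong (λ m → fromℕ (m !) * (1/[ n ]! * 1ℚ) * f m) (ℕ.+-identityʳ n) ⟩
  fromℕ (n !) * (1/[ n ]! * 1ℚ) * f n
    ≡⟨ solve 3 (λ a b p → a :* (b :* con 1ℚ) :* p := b :* a :* p) refl (fromℕ (n !)) 1/[ n ]! (f n) ⟩
  1/[ n ]! * fromℕ (n !) * f n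
    ≡⟨ cong (_* f n) (1/n!*n!≡1 n) ⟩
  1ℚ * f n
    ≡⟨ *-identityˡ (f n) ⟩
  f n ∎

-- The recursion of divided derivatives; k + 1 stays on the left as a factor that `𝔇-⊛` can cancel.
𝔇-suc : ∀ k f → (λ n → fromℕ (suc k) * 𝔇 (suc k) f n) ≗ δ (𝔇 k f)
𝔇-suc k f n = begin
  K * (fromℕ ((n ℕ.+ suc k) !) * (1/[ n ]! * 1/[ suc k ]!) * f (n ℕ.+ suc k))
    ≡⟨ cong (λ m → K * (fromℕ (m !) * (1/[ n ]! * 1/[ suc k ]!) * f m)) (ℕ.+-suc n k) ⟩
  K * (a * (1/[ n ]! * 1/[ suc k ]!) * p)
    ≡⟨ solve 5 (λ K a b q p → K :* (a :* (b :* q) :* p) := a :* (b :* (K :* q)) :* p) refl K a 1/[ n ]! 1/[ suc k ]! p ⟩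
  a * (1/[ n ]! * (K * 1/[ suc k ]!)) * p
    ≡⟨ cong₂ (λ b q → a * (b * q) * p) (sym (1/!-suc n)) (1/!-suc k) ⟩
  a * (N * 1/[ suc n ]! * 1/[ k ]!) * p
    ≡⟨ solve 5 (λ N a b q p → a :* (N :* b :* q) :* p := N :* (a :* (b :* q) :* p)) refl N a 1/[ suc n ]! 1/[ k ]! p ⟩
  N * (a * (1/[ suc n ]! * 1/[ k ]!) * p) ∎
  where
  K = fromℕ (suc k)
  N = fromℕ (suc n)
  a = fromℕ (suc (n ℕ.+ k) !)
  p = f (suc (n ℕ.+ k))

-- The factor 1/k! absorbs the binomial coefficients, so the Leibniz rule is a plain Cauchy sum.
-- Differentiating case k and regrouping by `conv-deriv` gives k + 1 times case k + 1.
𝔇-⊛ : ∀ k f g n → 𝔇 k (f ⊛ g) n ≡ conv k (λ a b → (𝔇 a f ⊛ 𝔇 b g) n)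
𝔇-⊛ zero    f g n = trans (𝔇-zero (f ⊛ g) n) (trans
  (⊛-cong (λ a → sym (𝔇-zero f a)) (λ b → sym (𝔇-zero g b)) n) (sym (conv-zero _)))
𝔇-⊛ (suc k) f g n = fromℕ-cancel k (begin
  fromℕ (suc k) * 𝔇 (suc k) (f ⊛ g) n
    ≡⟨ 𝔇-suc k (f ⊛ g) n ⟩
  fromℕ (suc n) * 𝔇 k (f ⊛ g) (suc n)
    ≡⟨ cong (fromℕ (suc n) *_) (𝔇-⊛ k f g (suc n)) ⟩
  fromℕ (suc n) * conv k (λ a b → (𝔇 a f ⊛ 𝔇 b g) (suc n))
    ≡⟨ conv-*ˡ k (fromℕ (suc n)) _ ⟨
  conv k (λ a b → δ (𝔇 a f ⊛ 𝔇 b g) n)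
    ≡⟨ conv-cong′ k (λ a b → δ-⊛ (𝔇 a f) (𝔇 b g) n) ⟩
  conv k (λ a b → (δ (𝔇 a f) ⊛ 𝔇 b g) n + (𝔇 a f ⊛ δ (𝔇 b g)) n)
    ≡⟨ conv-+ k _ _ ⟩
  conv k (λ a b → (δ (𝔇 a f) ⊛ 𝔇 b g) n) + conv k (λ a b → (𝔇 a f ⊛ δ (𝔇 b g)) n)
    ≡⟨ cong₂ _+_
         (conv-cong′ k (λ a b → trans (⊛-congˡ (𝔇 b g) (λ m → sym (𝔇-suc a f m)) n)
                                      (⊛-scaleˡ (fromℕ (suc a)) (𝔇 (suc a) f) (𝔇 b g) n)))
         (conv-cong′ k (λ a b → trans (⊛-congʳ (𝔇 a f) (λ m → sym (𝔇-suc b g m)) n)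
                                      (⊛-scaleʳ (fromℕ (suc b)) (𝔇 a f) (𝔇 (suc b) g) n))) ⟩
  conv k (λ a b → fromℕ (suc a) * (𝔇 (suc a) f ⊛ 𝔇 b g) n) +
  conv k (λ a b → fromℕ (suc b) * (𝔇 a f ⊛ 𝔇 (suc b) g) n)
    ≡⟨ conv-deriv k (λ a b → (𝔇 a f ⊛ 𝔇 b g) n) ⟨
  fromℕ (suc k) * conv (suc k) (λ a b → (𝔇 a f ⊛ 𝔇 b g) n) ∎)

-- Power series in several variables

-- Nesting one `conv` per coordinate reduces each law of `⊗` to the corresponding law of `conv`.
convᵛ : Vec ℕ n → (Vec ℕ n → Vec ℕ n → ℚ) → ℚ
convᵛ []       W = W [] []
convᵛ (k ∷ ks) W = conv k λ a b → convᵛ ks λ as bs → W (a ∷ as) (b ∷ bs)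

∑-below≡convᵛ : ∀ (k : Vec ℕ n) W → ∑ (below k) (λ a → W a (Vec.zipWith _∸_ k a)) ≡ convᵛ k W
∑-below≡convᵛ []       W = +-identityʳ _
∑-below≡convᵛ (k ∷ ks) W = begin
  ∑ (below (k ∷ ks)) (λ a → W a (Vec.zipWith _∸_ (k ∷ ks) a))
    ≡⟨ ∑-cartesianProductWith _∷_ (upTo (suc k)) (below ks) (λ a → W a (Vec.zipWith _∸_ (k ∷ ks) a)) ⟩
  ∑ (upTo (suc k)) (λ a → ∑ (below ks) (λ as → W (a ∷ as) (k ∸ a ∷ Vec.zipWith _∸_ ks as)))
    ≡⟨ ∑≡conv k (λ a b → ∑ (below ks) (λ as → W (a ∷ as) (b ∷ Vec.zipWith _∸_ ks as))) ⟩
  conv k (λ a b → ∑ (below ks) (λ as → W (a ∷ as) (b ∷ Vec.zipWith _∸_ ks as)))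
    ≡⟨ conv-cong′ k (λ a b → ∑-below≡convᵛ ks (λ as bs → W (a ∷ as) (b ∷ bs))) ⟩
  convᵛ (k ∷ ks) W ∎

⊗≡convᵛ : ∀ (p q : MSeries n) k → (p ⊗ q) k ≡ convᵛ k (λ a b → p a * q b)
⊗≡convᵛ p q k = ∑-below≡convᵛ k (λ a b → p a * q b)

convᵛ-cong : ∀ (k : Vec ℕ n) {V W} → (∀ a b → V a b ≡ W a b) → convᵛ k V ≡ convᵛ k W
convᵛ-cong []       eq = eq [] []
convᵛ-cong (k ∷ ks) eq = conv-cong′ k (λ a b → convᵛ-cong ks (λ as bs → eq (a ∷ as) (b ∷ bs)))

convᵛ-0 : ∀ (k : Vec ℕ n) → convᵛ k (λ _ _ → 0ℚ) ≡ 0ℚ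
convᵛ-0 []       = refl
convᵛ-0 (k ∷ ks) = trans (conv-cong′ k (λ a b → convᵛ-0 ks)) (conv-0 k)

convᵛ-*ˡ : ∀ (k : Vec ℕ n) x W → convᵛ k (λ a b → x * W a b) ≡ x * convᵛ k W
convᵛ-*ˡ []       x W = refl
convᵛ-*ˡ (k ∷ ks) x W = trans (conv-cong′ k (λ a b → convᵛ-*ˡ ks x (λ as bs → W (a ∷ as) (b ∷ bs))))
  (conv-*ˡ k x (λ a b → convᵛ ks λ as bs → W (a ∷ as) (b ∷ bs)))

convᵛ-*ʳ : ∀ (k : Vec ℕ n) x W → convᵛ k (λ a b → W a b * x) ≡ convᵛ k W * x
convᵛ-*ʳ k x W = trans (convᵛ-cong k (λ a b → *-comm (W a b) x)) (trans (convᵛ-*ˡ k x W) (*-comm x _))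

convᵛ-comm : ∀ (k : Vec ℕ n) W → convᵛ k W ≡ convᵛ k (λ a b → W b a)
convᵛ-comm []       W = refl
convᵛ-comm (k ∷ ks) W = trans (conv-comm k (λ a b → convᵛ ks λ as bs → W (a ∷ as) (b ∷ bs)))
  (conv-cong′ k (λ a b → convᵛ-comm ks (λ as bs → W (b ∷ as) (a ∷ bs))))

-- Interchange of two finite sums. In `convᵛ-assoc` it moves the sum of the first coordinate past
-- those of the others, and back.
conv-convᵛ : ∀ n (k : Vec ℕ n) m (W : ℕ → ℕ → Vec ℕ n → Vec ℕ n → ℚ) →
  conv m (λ a b → convᵛ k (W a b)) ≡ convᵛ k (λ as bs → conv m (λ a b → W a b as bs))
conv-convᵛ n []       m W = refl
conv-convᵛ (suc n) (k ∷ ks) m W = begin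
  conv m (λ a b → conv k (λ i j → convᵛ ks (λ is js → W a b (i ∷ is) (j ∷ js))))
    ≡⟨ conv-conv m k (λ a b i j → convᵛ ks (λ is js → W a b (i ∷ is) (j ∷ js))) ⟩
  conv k (λ i j → conv m (λ a b → convᵛ ks (λ is js → W a b (i ∷ is) (j ∷ js))))
    ≡⟨ conv-cong′ k (λ i j → conv-convᵛ n ks m (λ a b is js → W a b (i ∷ is) (j ∷ js))) ⟩
  conv k (λ i j → convᵛ ks (λ is js → conv m (λ a b → W a b (i ∷ is) (j ∷ js)))) ∎
  where
  conv-conv : ∀ m k (W : ℕ → ℕ → ℕ → ℕ → ℚ) →
    conv m (λ a b → conv k (W a b)) ≡ conv k (λ i j → conv m (λ a b → W a b i j))
  conv-conv zero    k W = trans (conv-zero _) (conv-cong′ k (λ i j → sym (conv-zero _)))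
  conv-conv (suc m) k W = trans (conv-suc m _) (trans
    (cong (conv k (W 0 (suc m)) +_) (conv-conv m k (λ a b → W (suc a) b))) (trans
    (sym (conv-+ k _ _)) (conv-cong′ k (λ i j → sym (conv-suc m _)))))

convᵛ-assoc : ∀ (k : Vec ℕ n) (W : Vec ℕ n → Vec ℕ n → Vec ℕ n → ℚ) →
  convᵛ k (λ a b → convᵛ a (λ i j → W i j b)) ≡ convᵛ k (λ i m → convᵛ m (W i))
convᵛ-assoc []       W = refl
convᵛ-assoc (k ∷ ks) W = begin
  conv k (λ a b → convᵛ ks (λ as bs → conv a (λ i j → convᵛ as (λ is js → W (i ∷ is) (j ∷ js) (b ∷ bs)))))
    ≡⟨ conv-cong′ k (λ a b → conv-convᵛ _ ks a (λ i j as bs → convᵛ as (λ is js → W (i ∷ is) (j ∷ js) (b ∷ bs)))) ⟨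
  conv k (λ a b → conv a (λ i j → convᵛ ks (λ as bs → convᵛ as (λ is js → W (i ∷ is) (j ∷ js) (b ∷ bs)))))
    ≡⟨ conv-cong′ k (λ a b → conv-cong′ a (λ i j → convᵛ-assoc ks (λ is js bs → W (i ∷ is) (j ∷ js) (b ∷ bs)))) ⟩
  conv k (λ a b → conv a (λ i j → convᵛ ks (λ is ms → convᵛ ms (λ js bs → W (i ∷ is) (j ∷ js) (b ∷ bs)))))
    ≡⟨ conv-assoc k (λ i j b → convᵛ ks (λ is ms → convᵛ ms (λ js bs → W (i ∷ is) (j ∷ js) (b ∷ bs)))) ⟩
  conv k (λ i m → conv m (λ j b → convᵛ ks (λ is ms → convᵛ ms (λ js bs → W (i ∷ is) (j ∷ js) (b ∷ bs)))))
    ≡⟨ conv-cong′ k (λ i m → conv-convᵛ _ ks m (λ j b is ms → convᵛ ms (λ js bs → W (i ∷ is) (j ∷ js) (b ∷ bs)))) ⟩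
  conv k (λ i m → convᵛ ks (λ is ms → conv m (λ j b → convᵛ ms (λ js bs → W (i ∷ is) (j ∷ js) (b ∷ bs))))) ∎

⊗-cong : ρ ≗ ρ′ → σ ≗ σ′ → ρ ⊗ σ ≗ ρ′ ⊗ σ′
⊗-cong {ρ = ρ} {ρ′} {σ} {σ′} ρ≗ρ′ σ≗σ′ k = trans (⊗≡convᵛ ρ σ k) (trans
  (convᵛ-cong k (λ a b → cong₂ _*_ (ρ≗ρ′ a) (σ≗σ′ b))) (sym (⊗≡convᵛ ρ′ σ′ k)))

⊗-comm : ∀ (p q : MSeries n) → p ⊗ q ≗ q ⊗ p
⊗-comm p q k = trans (⊗≡convᵛ p q k) (trans (convᵛ-comm k (λ a b → p a * q b)) (trans
  (convᵛ-cong k (λ a b → *-comm (p b) (q a))) (sym (⊗≡convᵛ q p k))))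

⊗-assoc : ∀ (p q r : MSeries n) → p ⊗ q ⊗ r ≗ p ⊗ (q ⊗ r)
⊗-assoc p q r k = begin
  (p ⊗ q ⊗ r) k
    ≡⟨ ⊗≡convᵛ (p ⊗ q) r k ⟩
  convᵛ k (λ a b → (p ⊗ q) a * r b)
    ≡⟨ convᵛ-cong k (λ a b → trans (cong (_* r b) (⊗≡convᵛ p q a)) (sym (convᵛ-*ʳ a (r b) (λ i j → p i * q j)))) ⟩
  convᵛ k (λ a b → convᵛ a (λ i j → p i * q j * r b))
    ≡⟨ convᵛ-assoc k (λ i j b → p i * q j * r b) ⟩
  convᵛ k (λ i m → convᵛ m (λ j b → p i * q j * r b))
    ≡⟨ convᵛ-cong k (λ i m → trans (convᵛ-cong m (λ j b → *-assoc (p i) (q j) (r b)))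
         (trans (convᵛ-*ˡ m (p i) (λ j b → q j * r b)) (cong (p i *_) (sym (⊗≡convᵛ q r m))))) ⟩
  convᵛ k (λ i m → p i * (q ⊗ r) m)
    ≡⟨ ⊗≡convᵛ p (q ⊗ r) k ⟨
  (p ⊗ (q ⊗ r)) k ∎

-- A series in t₂, …, tₙ₊₁ as one in t₁, …, tₙ₊₁.
lift : MSeries n → MSeries (suc n)
lift p (zero  ∷ ks) = p ks
lift p (suc _ ∷ ks) = 0ℚ

lift-cong : ρ ≗ σ → lift ρ ≗ lift σ
lift-cong ρ≗σ (zero  ∷ ks) = ρ≗σ ks
lift-cong ρ≗σ (suc _ ∷ ks) = refl

conv-last : ∀ k W → (∀ a b → W a (suc b) ≡ 0ℚ) → conv k W ≡ W k 0
conv-last zero    W W≡0 = conv-zero W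
conv-last (suc k) W W≡0 = trans (conv-sucʳ k W) (trans
  (cong (_+ W (suc k) 0) (trans (conv-cong′ k W≡0) (conv-0 k))) (+-identityˡ (W (suc k) 0)))

-- A factor free of t₁ leaves the exponent of t₁ to the other factor. This is what allows the
-- variables to be treated one at a time.
⊗-lift : ∀ (p : MSeries (suc n)) q k ks → (p ⊗ lift q) (k ∷ ks) ≡ ((λ as → p (k ∷ as)) ⊗ q) ks
⊗-lift p q k ks = trans (⊗≡convᵛ p (lift q) (k ∷ ks)) (trans
  (conv-last k (λ a b → convᵛ ks λ as bs → p (a ∷ as) * lift q (b ∷ bs))
    (λ a b → trans (convᵛ-cong ks (λ as bs → *-zeroʳ (p (a ∷ as)))) (convᵛ-0 ks)))
  (sym (⊗≡convᵛ (λ as → p (k ∷ as)) q ks)))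

lift-⊗ : ∀ (p q : MSeries n) → lift p ⊗ lift q ≗ lift (p ⊗ q)
lift-⊗ p q (zero  ∷ ks) = ⊗-lift (lift p) q 0 ks
lift-⊗ p q (suc k ∷ ks) = trans (⊗-lift (lift p) q (suc k) ks) (trans
  (⊗≡convᵛ (λ _ → 0ℚ) q ks) (trans (convᵛ-cong ks (λ a b → *-zeroˡ (q b))) (convᵛ-0 ks)))

𝟙≗lift-𝟙 : 𝟙 {suc n} ≗ lift 𝟙
𝟙≗lift-𝟙 (zero  ∷ ks) = refl
𝟙≗lift-𝟙 (suc _ ∷ ks) = refl

⊗-identityʳ : ∀ (p : MSeries n) → p ⊗ 𝟙 ≗ p
⊗-identityʳ p []       = trans (⊗≡convᵛ p 𝟙 []) (*-identityʳ (p []))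
⊗-identityʳ p (k ∷ ks) = trans (⊗-cong {ρ = p} (λ _ → refl) 𝟙≗lift-𝟙 (k ∷ ks)) (trans
  (⊗-lift p 𝟙 k ks) (⊗-identityʳ (λ as → p (k ∷ as)) ks))

⊗-identityˡ : ∀ (p : MSeries n) → 𝟙 ⊗ p ≗ p
⊗-identityˡ p k = trans (⊗-comm 𝟙 p k) (⊗-identityʳ p k)

∏! 1/∏! : Vec ℕ n → ℚ
∏!   = Vec.foldr′ (λ a s → fromℕ (a !) * s) 1ℚ
1/∏! = Vec.foldr′ (λ a s → 1/[ a ]! * s) 1ℚ

-- f (t₁ + ⋯ + tₙ), by the multinomial theorem.
T : Series → MSeries n
T f r = fromℕ (sum r !) * 1/∏! r * f (sum r)

T-cong : f ≗ g → T {n} f ≗ T g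
T-cong f≗g r = cong (fromℕ (sum r !) * 1/∏! r *_) (f≗g (sum r))

-- Taylor's formula f(t₁ + s) = Σ t₁ᵏ (𝔇 k f)(s) with s the sum of the remaining variables.
T-∷ : ∀ f k (r : Vec ℕ n) → T f (k ∷ r) ≡ T (𝔇 k f) r
T-∷ f k r = begin
  fromℕ ((k ℕ.+ sum r) !) * (1/[ k ]! * R) * f (k ℕ.+ sum r)
    ≡⟨ cong (λ m → fromℕ (m !) * (1/[ k ]! * R) * f m) (ℕ.+-comm k (sum r)) ⟩
  A * (1/[ k ]! * R) * F
    ≡⟨ solve 4 (λ A K R F → A :* (K :* R) :* F := con 1ℚ :* (A :* (K :* R) :* F)) refl A 1/[ k ]! R F ⟩
  -- The inserted 1 supplies (sum r)! for the outer `T` and 1/(sum r)! for `𝔇 k`.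
  1ℚ * (A * (1/[ k ]! * R) * F)
    ≡⟨ cong (_* (A * (1/[ k ]! * R) * F)) (1/n!*n!≡1 (sum r)) ⟨
  1/[ sum r ]! * fromℕ (sum r !) * (A * (1/[ k ]! * R) * F)
    ≡⟨ solve 6 (λ s S A K R F → s :* S :* (A :* (K :* R) :* F) := S :* R :* (A :* (s :* K) :* F)) refl
         1/[ sum r ]! (fromℕ (sum r !)) A 1/[ k ]! R F ⟩
  fromℕ (sum r !) * R * (A * (1/[ sum r ]! * 1/[ k ]!) * F) ∎
  where
  R = 1/∏! r
  A = fromℕ ((sum r ℕ.+ k) !)
  F = f (sum r ℕ.+ k)

-- Substituting t₁ + ⋯ + tₙ is multiplicative: `T-∷` takes the coefficient in t₁, `𝔇-⊛` expands it,
-- and the induction handles the other variables.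
T-⊛ : ∀ f g → T {n} (f ⊛ g) ≗ T f ⊗ T g
T-⊛ f g [] = trans (cong (_*_ 1ℚ) (⊛-zero f g)) (trans
  (solve 2 (λ a b → con 1ℚ :* (a :* b) := con 1ℚ :* a :* (con 1ℚ :* b)) refl (f 0) (g 0))
  (sym (⊗≡convᵛ (T f) (T g) [])))
T-⊛ f g (k ∷ r) = begin
  T (f ⊛ g) (k ∷ r)
    ≡⟨ T-∷ (f ⊛ g) k r ⟩
  w * 𝔇 k (f ⊛ g) (sum r)
    ≡⟨ cong (w *_) (𝔇-⊛ k f g (sum r)) ⟩
  w * conv k (λ a b → (𝔇 a f ⊛ 𝔇 b g) (sum r))
    ≡⟨ conv-*ˡ k w _ ⟨
  conv k (λ a b → T (𝔇 a f ⊛ 𝔇 b g) r)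
    ≡⟨ conv-cong′ k (λ a b → trans (T-⊛ (𝔇 a f) (𝔇 b g) r) (trans
         (⊗≡convᵛ (T (𝔇 a f)) (T (𝔇 b g)) r)
         (convᵛ-cong r (λ as bs → cong₂ _*_ (sym (T-∷ f a as)) (sym (T-∷ g b bs)))))) ⟩
  convᵛ (k ∷ r) (λ a b → T f a * T g b)
    ≡⟨ ⊗≡convᵛ (T f) (T g) (k ∷ r) ⟨
  (T f ⊗ T g) (k ∷ r) ∎
  where
  w = fromℕ (sum r !) * 1/∏! r

T-zero : (∀ m → f m ≡ 0ℚ) → ∀ (r : Vec ℕ n) → T f r ≡ 0ℚ
T-zero f≡0 r = trans (cong (fromℕ (sum r !) * 1/∏! r *_) (f≡0 (sum r))) (*-zeroʳ (fromℕ (sum r !) * 1/∏! r))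

𝔇-vanish : ∀ k f m → f (m ℕ.+ k) ≡ 0ℚ → 𝔇 k f m ≡ 0ℚ
𝔇-vanish k f m eq = trans (cong (fromℕ ((m ℕ.+ k) !) * (1/[ m ]! * 1/[ k ]!) *_) eq)
  (*-zeroʳ (fromℕ ((m ℕ.+ k) !) * (1/[ m ]! * 1/[ k ]!)))

T-1 : T {n} (const 1ℚ) ≗ 𝟙
T-1 []          = refl
T-1 (zero  ∷ r) = trans (T-∷ (const 1ℚ) 0 r) (trans (T-cong (𝔇-zero (const 1ℚ)) r) (T-1 r))
T-1 (suc k ∷ r) = trans (T-∷ (const 1ℚ) (suc k) r) (T-zero
  (λ m → 𝔇-vanish (suc k) (const 1ℚ) m (cong (const 1ℚ) (ℕ.+-suc m k))) r)

X-suc : ∀ m → X (suc m) ≡ const 1ℚ m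
X-suc zero    = refl
X-suc (suc m) = refl

T-X : T {n} X ≗ (λ k → ∑ (allFin n) (λ j → t j k))
T-X []       = refl
T-X {suc n} (k ∷ r) = begin
  T X (k ∷ r)
    ≡⟨ T-∷ X k r ⟩
  T (𝔇 k X) r
    ≡⟨ split k ⟩
  t zero (k ∷ r) + lift (λ r → ∑ (allFin n) (λ j → t j r)) (k ∷ r)
    ≡⟨ cong (t zero (k ∷ r) +_) (lift-∑ k) ⟩
  t zero (k ∷ r) + ∑ (allFin n) (λ j → t (suc j) (k ∷ r))
    ≡⟨ cong (t zero (k ∷ r) +_) (∑-map suc (allFin n) (λ j → t j (k ∷ r))) ⟨
  t zero (k ∷ r) + ∑ (map suc (allFin n)) (λ j → t j (k ∷ r))
    ≡⟨ cong (λ js → t zero (k ∷ r) + ∑ js (λ j → t j (k ∷ r))) (List.map-tabulate (λ j → j) suc) ⟩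
  ∑ (allFin (suc n)) (λ j → t j (k ∷ r)) ∎
  where
  lift-∑ : ∀ k → lift (λ r → ∑ (allFin n) (λ j → t j r)) (k ∷ r) ≡ ∑ (allFin n) (λ j → t (suc j) (k ∷ r))
  lift-∑ zero    = refl
  lift-∑ (suc k) = sym (∑-0 (allFin n))
  -- By Taylor's formula in t₁: order 0 leaves X in the remaining variables, order 1 leaves the
  -- derivative 1, and higher orders vanish.
  split : ∀ k → T (𝔇 k X) r ≡ t zero (k ∷ r) + lift (λ r → ∑ (allFin n) (λ j → t j r)) (k ∷ r)
  split zero = trans (T-cong (𝔇-zero X) r) (trans (T-X r) (sym (+-identityˡ _)))
  split (suc zero) = trans (T-cong 𝔇-X r) (trans (T-1 r) (sym (+-identityʳ (𝟙 r))))
    where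
    𝔇-X : 𝔇 1 X ≗ const 1ℚ
    𝔇-X zero    = refl
    𝔇-X (suc m) = 𝔇-vanish 1 X (suc m) (trans (X-suc (m ℕ.+ 1)) (cong (const 1ℚ) (ℕ.+-comm m 1)))
  split (suc (suc k)) = T-zero (λ m → 𝔇-vanish (suc (suc k)) X m (trans
    (cong X (ℕ.+-suc m (suc k))) (trans (X-suc (m ℕ.+ suc k)) (cong (const 1ℚ) (ℕ.+-suc m k))))) r

-- Substitution into a power series

pow-X-suc : ∀ m n → pow X (suc m) (suc n) ≡ pow X m n
pow-X-suc m n = trans (divZ-⊛ X (pow X m) refl n) (trans (⊛-congˡ (pow X m) X-suc n) (⊛-identityˡ (pow X m) n))

∑-pow-X : ∀ f n → ∑ (upTo (suc n)) (λ m → f m * pow X m n) ≡ f n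
∑-pow-X f zero    = trans (+-identityʳ _) (*-identityʳ (f 0))
∑-pow-X f (suc n) = begin
  ∑ (upTo (suc (suc n))) (λ m → f m * pow X m (suc n))
    ≡⟨ ∑-upTo-suc (suc n) (λ m → f m * pow X m (suc n)) ⟩
  f 0 * 0ℚ + ∑ (upTo (suc n)) (λ m → f (suc m) * pow X (suc m) (suc n))
    ≡⟨ cong₂ _+_ (*-zeroʳ (f 0)) (∑-cong (upTo (suc n)) {λ m → f (suc m) * pow X (suc m) (suc n)}
         (λ m → cong (f (suc m) *_) (pow-X-suc m n))) ⟩
  0ℚ + ∑ (upTo (suc n)) (λ m → f (suc m) * pow X m n)
    ≡⟨ +-identityˡ (∑ (upTo (suc n)) (λ m → f (suc m) * pow X m n)) ⟩
  ∑ (upTo (suc n)) (λ m → f (suc m) * pow X m n)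
    ≡⟨ ∑-pow-X (λ m → f (suc m)) n ⟩
  f (suc n) ∎

T-pow : ∀ f m → T {n} (pow f m) ≗ mpow (T f) m
T-pow f zero    k = T-1 k
T-pow f (suc m) k = trans (T-⊛ f (pow f m) k) (⊗-cong {ρ = T f} (λ _ → refl) (T-pow f m) k)

mpow-cong : ρ ≗ σ → ∀ m → mpow ρ m ≗ mpow σ m
mpow-cong ρ≗σ zero    k = refl
mpow-cong ρ≗σ (suc m) k = ⊗-cong ρ≗σ (mpow-cong ρ≗σ m) k

substitute-congʳ : ∀ f → ρ ≗ σ → substitute f ρ ≗ substitute f σ
substitute-congʳ {ρ = ρ} f ρ≗σ k = ∑-cong (upTo (suc (sum k))) {λ m → f m * mpow ρ m k}
  (λ m → cong (f m *_) (mpow-cong ρ≗σ m k))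

-- Since `T` is multiplicative, (t₁ + ⋯ + tₙ)ᵐ is `T (pow X m)`. At k it is a fixed multinomial
-- weight times a coefficient of Xᵐ, so the claim reduces to f(X) = f.
substitute-T-X : ∀ f → substitute f (T {n} X) ≗ T f
substitute-T-X f k = begin
  ∑ (upTo (suc (sum k))) (λ m → f m * mpow (T X) m k)
    ≡⟨ ∑-cong (upTo (suc (sum k))) {λ m → f m * mpow (T X) m k} (λ m → trans (cong (f m *_) (sym (T-pow X m k)))
         (solve 3 (λ a b w → a :* (w :* b) := w :* (a :* b)) refl (f m) (pow X m (sum k)) w)) ⟩
  ∑ (upTo (suc (sum k))) (λ m → w * (f m * pow X m (sum k)))
    ≡⟨ ∑-*ˡ (upTo (suc (sum k))) w (λ m → f m * pow X m (sum k)) ⟩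
  w * ∑ (upTo (suc (sum k))) (λ m → f m * pow X m (sum k))
    ≡⟨ cong (w *_) (∑-pow-X f (sum k)) ⟩
  T f k ∎
  where
  w = fromℕ (sum k !) * 1/∏! k

mpow-lift : ∀ (p : MSeries n) m → mpow (lift p) m ≗ lift (mpow p m)
mpow-lift p zero    = 𝟙≗lift-𝟙
mpow-lift p (suc m) k = trans (⊗-cong {ρ = lift p} (λ _ → refl) (mpow-lift p m) k) (lift-⊗ p (mpow p m) k)

-- At exponent 0 in t₁ both truncations stop at the same total degree; at a positive exponent every
-- power of the lifted series vanishes.
substitute-lift : ∀ f (p : MSeries n) → substitute f (lift p) ≗ lift (substitute f p)
substitute-lift f p (zero  ∷ ks) = ∑-cong (upTo (suc (sum ks))) {λ m → f m * mpow (lift p) m (0 ∷ ks)}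
  (λ m → cong (f m *_) (mpow-lift p m (0 ∷ ks)))
substitute-lift f p (suc k ∷ ks) = trans
  (∑-cong (upTo (suc (suc k ℕ.+ sum ks))) {λ m → f m * mpow (lift p) m (suc k ∷ ks)}
    (λ m → trans (cong (f m *_) (mpow-lift p m (suc k ∷ ks))) (*-zeroʳ (f m))))
  (∑-0 (upTo (suc (suc k ℕ.+ sum ks))))

∑-filter : ∀ {P : J → Set} (P? : Decidable P) xs (f : J → ℚ) →
  ∑ (filter P? xs) f ≡ ∑ xs (λ i → if does (P? i) then f i else 0ℚ)
∑-filter P? []       f = refl
∑-filter P? (i ∷ xs) f with does (P? i)
... | true  = cong (f i +_) (∑-filter P? xs f)
... | false = trans (∑-filter P? xs f) (sym (+-identityˡ _))

tailSum-zero : tailSum {suc n} zero ≗ T X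
tailSum-zero {n} k = trans (∑-filter (Fin._≤?_ {suc n} zero) (allFin (suc n)) (λ j → t j k)) (sym (T-X k))

tailSum-suc : ∀ (i : Fin n) → tailSum (suc i) ≗ lift (tailSum i)
tailSum-suc {n} i (k ∷ ks) = begin
  tailSum (suc i) (k ∷ ks)
    ≡⟨ ∑-filter (suc i Fin.≤?_) (allFin (suc n)) (λ j → t j (k ∷ ks)) ⟩
  0ℚ + ∑ (tabulate suc) F
    ≡⟨ +-identityˡ (∑ (tabulate suc) F) ⟩
  ∑ (tabulate suc) F
    ≡⟨ cong (λ js → ∑ js F) (List.map-tabulate (λ j → j) suc) ⟨
  ∑ (map suc (allFin n)) F
    ≡⟨ ∑-map suc (allFin n) F ⟩
  ∑ (allFin n) (λ j → F (suc j))
    ≡⟨ ∑-cong (allFin n) (λ j → cong (λ b → if b then t (suc j) (k ∷ ks) else 0ℚ) (does-≤? i j)) ⟩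
  ∑ (allFin n) (λ j → if does (i Fin.≤? j) then t (suc j) (k ∷ ks) else 0ℚ)
    ≡⟨ ∑-filter (i Fin.≤?_) (allFin n) (λ j → t (suc j) (k ∷ ks)) ⟨
  ∑ (filter (i Fin.≤?_) (allFin n)) (λ j → t (suc j) (k ∷ ks))
    ≡⟨ lift-∑ k ⟩
  lift (tailSum i) (k ∷ ks) ∎
  where
  F : Fin (suc n) → ℚ
  F j = if does (suc i Fin.≤? j) then t j (k ∷ ks) else 0ℚ
  does-≤? : ∀ {n} (i j : Fin n) → does (suc i Fin.≤? suc j) ≡ does (i Fin.≤? j)
  does-≤? zero    j = refl
  does-≤? (suc i) j = refl
  lift-∑ : ∀ k → ∑ (filter (i Fin.≤?_) (allFin n)) (λ j → t (suc j) (k ∷ ks)) ≡ lift (tailSum i) (k ∷ ks)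
  lift-∑ zero    = refl
  lift-∑ (suc k) = ∑-0 (filter (i Fin.≤?_) (allFin n))

∏ᴹ-lift : ∀ (js : List (Fin n)) {F : Fin (suc n) → MSeries (suc n)} {G : Fin n → MSeries n} →
  (∀ j → F (suc j) ≗ lift (G j)) → ∏ᴹ (map suc js) F ≗ lift (∏ᴹ js G)
∏ᴹ-lift []       F≗G k = 𝟙≗lift-𝟙 k
∏ᴹ-lift (j ∷ js) {F} {G} F≗G k = trans (⊗-cong (F≗G j) (∏ᴹ-lift js {F} {G} F≗G) k) (lift-⊗ (G j) (∏ᴹ js G) k)

-- The product ∏ᵢ f (tᵢ + ⋯ + tₙ), one variable at a time.
Q : Series → ∀ {n} → MSeries n
Q f {zero}  = 𝟙
Q f {suc n} = T f ⊗ lift (Q f)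

∏ᴹ-substitute : ∀ f n → ∏ᴹ (allFin n) (λ i → substitute f (tailSum i)) ≗ Q f
∏ᴹ-substitute f zero    k = refl
∏ᴹ-substitute f (suc n) k = ⊗-cong {ρ = substitute f (tailSum {suc n} zero)}
  (λ k → trans (substitute-congʳ f tailSum-zero k) (substitute-T-X f k))
  (λ k → trans (cong (λ js → ∏ᴹ js (λ i → substitute f (tailSum i)) k) (sym (List.map-tabulate (λ j → j) suc)))
    (trans (∏ᴹ-lift (allFin n) {λ i → substitute f (tailSum i)} {λ i → substitute f (tailSum i)} (λ j k → trans (substitute-congʳ f (tailSum-suc j) k) (substitute-lift f (tailSum j) k)) k)
      (lift-cong (∏ᴹ-substitute f n) k))) k

-- Laurent series

private variable
  a a′ b b′ : 𝒜

-- A name for the extension by zero inside `coeff`, so that shifts of the index can be rewritten.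
at : Series → ℤ.ℤ → ℚ
at f (ℤ.+ n)    = f n
at f ℤ.-[1+ _ ] = 0ℚ

coeff≡at : ∀ f N i → coeff (f /z^ N) i ≡ at f (i ℤ.+ ℤ.+ N)
coeff≡at f N i with i ℤ.+ ℤ.+ N
... | ℤ.+ n      = refl
... | ℤ.-[1+ _ ] = refl

at-cong : f ≗ g → ∀ i → at f i ≡ at g i
at-cong f≗g (ℤ.+ n)    = f≗g n
at-cong f≗g ℤ.-[1+ _ ] = refl

at-⊕ : ∀ f g i → at (f ⊕ g) i ≡ at f i + at g i
at-⊕ f g (ℤ.+ n)    = refl
at-⊕ f g ℤ.-[1+ _ ] = refl

at-* : ∀ c f i → at (λ n → c * f n) i ≡ c * at f i
at-* c f (ℤ.+ n)    = refl
at-* c f ℤ.-[1+ _ ] = sym (*-zeroʳ c)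

at-mulZ : ∀ f i → at (mulZ f) (ℤ.suc i) ≡ at f i
at-mulZ f (ℤ.+ n)        = refl
at-mulZ f ℤ.-[1+ zero ]  = refl
at-mulZ f ℤ.-[1+ suc _ ] = refl

≗⇒≈ : ∀ {N M} → f ≗ g → N ≡ M → (f /z^ N) ≈ (g /z^ M)
≗⇒≈ {f} {g} {N} f≗g refl i = trans (coeff≡at f N i) (trans (at-cong f≗g (i ℤ.+ ℤ.+ N)) (sym (coeff≡at g N i)))

coeff-⊕ : ∀ f g N i → coeff ((f ⊕ g) /z^ N) i ≡ coeff (f /z^ N) i + coeff (g /z^ N) i
coeff-⊕ f g N i = trans (coeff≡at (f ⊕ g) N i) (trans (at-⊕ f g (i ℤ.+ ℤ.+ N))
  (sym (cong₂ _+_ (coeff≡at f N i) (coeff≡at g N i))))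

coeff-· : ∀ c a i → coeff (c ·ᴬ a) i ≡ c * coeff a i
coeff-· c (f /z^ N) i = trans (coeff≡at _ N i) (trans (at-* c f (i ℤ.+ ℤ.+ N)) (cong (c *_) (sym (coeff≡at f N i))))

shift : ∀ i N → i ℤ.+ ℤ.+ suc N ≡ ℤ.suc (i ℤ.+ ℤ.+ N)
shift i N = trans (cong (ℤ._+_ i) (ℤ.pos-+ 1 N)) (trans (sym (ℤ.+-assoc i (ℤ.+ 1) (ℤ.+ N)))
  (trans (cong (ℤ._+ ℤ.+ N) (ℤ.+-comm i (ℤ.+ 1))) (ℤ.+-assoc (ℤ.+ 1) i (ℤ.+ N))))

mulZ-pole : ∀ f N → (mulZ f /z^ suc N) ≈ (f /z^ N)
mulZ-pole f N i = begin
  coeff (mulZ f /z^ suc N) i            ≡⟨ coeff≡at (mulZ f) (suc N) i ⟩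
  at (mulZ f) (i ℤ.+ ℤ.+ suc N)         ≡⟨ cong (at (mulZ f)) (shift i N) ⟩
  at (mulZ f) (ℤ.suc (i ℤ.+ ℤ.+ N))     ≡⟨ at-mulZ f (i ℤ.+ ℤ.+ N) ⟩
  at f (i ℤ.+ ℤ.+ N)                    ≡⟨ coeff≡at f N i ⟨
  coeff (f /z^ N) i                     ∎

mulZ^-pole : ∀ M f N → (mulZ^ M f /z^ (M ℕ.+ N)) ≈ (f /z^ N)
mulZ^-pole zero    f N i = refl
mulZ^-pole (suc M) f N i = trans (mulZ-pole (mulZ^ M f) (M ℕ.+ N) i) (mulZ^-pole M f N i)

coeff-num : ∀ f N n → coeff (f /z^ N) (ℤ.+ n ℤ.- ℤ.+ N) ≡ f n
coeff-num f N n = trans (coeff≡at f N (ℤ.+ n ℤ.- ℤ.+ N)) (cong (at f) (trans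
  (ℤ.+-assoc (ℤ.+ n) (ℤ.- ℤ.+ N) (ℤ.+ N)) (trans (cong (ℤ._+_ (ℤ.+ n)) (ℤ.+-inverseˡ (ℤ.+ N))) (ℤ.+-identityʳ (ℤ.+ n)))))

mulZ^-⊛ : ∀ M f g → mulZ^ M f ⊛ g ≗ mulZ^ M (f ⊛ g)
mulZ^-⊛ zero    f g n = refl
mulZ^-⊛ (suc M) f g n = trans (mulZ-⊛ (mulZ^ M f) g n) (mulZ-cong (mulZ^-⊛ M f g) n)

*ᴬ-comm : ∀ a b → a *ᴬ b ≈ b *ᴬ a
*ᴬ-comm (f /z^ N) (g /z^ M) = ≗⇒≈ (⊛-comm f g) (ℕ.+-comm N M)

-- Equal Laurent series may be written with different poles N and N′. Over the common denominator
-- z^{N + N′} their numerators coincide, and the product of series respects that.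
*ᴬ-congˡ : ∀ b → a ≈ a′ → a *ᴬ b ≈ a′ *ᴬ b
*ᴬ-congˡ {f /z^ N} {f′ /z^ N′} (g /z^ M) a≈a′ i = begin
  coeff ((f ⊛ g) /z^ (N ℕ.+ M)) i
    ≡⟨ mulZ^-pole N′ (f ⊛ g) (N ℕ.+ M) i ⟨
  coeff (mulZ^ N′ (f ⊛ g) /z^ (N′ ℕ.+ (N ℕ.+ M))) i
    ≡⟨ ≗⇒≈ same (trans (sym (ℕ.+-assoc N′ N M)) (trans (cong (ℕ._+ M) (ℕ.+-comm N′ N)) (ℕ.+-assoc N N′ M))) i ⟩
  coeff (mulZ^ N (f′ ⊛ g) /z^ (N ℕ.+ (N′ ℕ.+ M))) i
    ≡⟨ mulZ^-pole N (f′ ⊛ g) (N′ ℕ.+ M) i ⟩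
  coeff ((f′ ⊛ g) /z^ (N′ ℕ.+ M)) i ∎
  where
  nums : mulZ^ N′ f ≗ mulZ^ N f′
  nums n = begin
    mulZ^ N′ f n
      ≡⟨ coeff-num (mulZ^ N′ f) (N′ ℕ.+ N) n ⟨
    coeff (mulZ^ N′ f /z^ (N′ ℕ.+ N)) j
      ≡⟨ trans (mulZ^-pole N′ f N j) (trans (a≈a′ j) (sym (mulZ^-pole N f′ N′ j))) ⟩
    coeff (mulZ^ N f′ /z^ (N ℕ.+ N′)) j
      ≡⟨ ≗⇒≈ {mulZ^ N f′} (λ _ → refl) (ℕ.+-comm N N′) j ⟩
    coeff (mulZ^ N f′ /z^ (N′ ℕ.+ N)) j
      ≡⟨ coeff-num (mulZ^ N f′) (N′ ℕ.+ N) n ⟩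
    mulZ^ N f′ n ∎
    where j = ℤ.+ n ℤ.- ℤ.+ (N′ ℕ.+ N)
  same : mulZ^ N′ (f ⊛ g) ≗ mulZ^ N (f′ ⊛ g)
  same n = trans (sym (mulZ^-⊛ N′ f g n)) (trans (⊛-congˡ g nums n) (mulZ^-⊛ N f′ g n))

*ᴬ-cong : a ≈ a′ → b ≈ b′ → a *ᴬ b ≈ a′ *ᴬ b′
*ᴬ-cong {a} {a′} {b} {b′} a≈a′ b≈b′ i = trans (*ᴬ-congˡ b a≈a′ i) (trans (*ᴬ-comm a′ b i)
  (trans (*ᴬ-congˡ a′ b≈b′ i) (*ᴬ-comm b′ a′ i)))

*ᴬ-identityʳ : ∀ a → a *ᴬ 1ᴬ ≈ a
*ᴬ-identityʳ (f /z^ N) = ≗⇒≈ (⊛-identityʳ f) (ℕ.+-identityʳ N)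

*ᴬ-identityˡ : ∀ a → 1ᴬ *ᴬ a ≈ a
*ᴬ-identityˡ (f /z^ N) = ≗⇒≈ (⊛-identityˡ f) refl

coeff-zero : ∀ a → (∀ n → num a n ≡ 0ℚ) → ∀ i → coeff a i ≡ 0ℚ
coeff-zero (f /z^ N) f≡0 i = trans (coeff≡at f N i) (lemma (i ℤ.+ ℤ.+ N))
  where
  lemma : ∀ i → at f i ≡ 0ℚ
  lemma (ℤ.+ n)    = f≡0 n
  lemma ℤ.-[1+ _ ] = refl

const-0 : ∀ n → const 0ℚ n ≡ 0ℚ
const-0 zero    = refl
const-0 (suc n) = refl

coeff-0ᴬ : ∀ i → coeff 0ᴬ i ≡ 0ℚ
coeff-0ᴬ = coeff-zero 0ᴬ const-0

coeff-+ᴬ : ∀ a b i → coeff (a +ᴬ b) i ≡ coeff a i + coeff b i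
coeff-+ᴬ (f /z^ N) (g /z^ M) i = begin
  coeff ((mulZ^ M f ⊕ mulZ^ N g) /z^ (N ℕ.+ M)) i
    ≡⟨ coeff-⊕ (mulZ^ M f) (mulZ^ N g) (N ℕ.+ M) i ⟩
  coeff (mulZ^ M f /z^ (N ℕ.+ M)) i + coeff (mulZ^ N g /z^ (N ℕ.+ M)) i
    ≡⟨ cong₂ _+_
         (trans (≗⇒≈ {mulZ^ M f} (λ _ → refl) (ℕ.+-comm N M) i) (mulZ^-pole M f N i))
         (mulZ^-pole N g M i) ⟩
  coeff (f /z^ N) i + coeff (g /z^ M) i ∎

coeff-∑ᴬ : ∀ (xs : List J) (F : J → 𝒜) i → coeff (∑ᴬ xs F) i ≡ ∑ xs (λ s → coeff (F s) i)
coeff-∑ᴬ []       F i = coeff-0ᴬ i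
coeff-∑ᴬ (s ∷ xs) F i = trans (coeff-+ᴬ (F s) (∑ᴬ xs F) i) (cong (coeff (F s) i +_) (coeff-∑ᴬ xs F i))

*ᴬ-distribˡ-+ᴬ : ∀ a b b′ i → coeff (a *ᴬ (b +ᴬ b′)) i ≡ coeff (a *ᴬ b) i + coeff (a *ᴬ b′) i
*ᴬ-distribˡ-+ᴬ (f /z^ N) (g /z^ M) (g′ /z^ M′) i = begin
  coeff ((f ⊛ (mulZ^ M′ g ⊕ mulZ^ M g′)) /z^ (N ℕ.+ (M ℕ.+ M′))) i
    ≡⟨ ≗⇒≈ nums (poles N M M′) i ⟩
  coeff ((mulZ^ M′ (f ⊛ g) ⊕ mulZ^ M (f ⊛ g′)) /z^ (M′ ℕ.+ (N ℕ.+ M))) i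
    ≡⟨ coeff-⊕ (mulZ^ M′ (f ⊛ g)) (mulZ^ M (f ⊛ g′)) (M′ ℕ.+ (N ℕ.+ M)) i ⟩
  coeff (mulZ^ M′ (f ⊛ g) /z^ (M′ ℕ.+ (N ℕ.+ M))) i + coeff (mulZ^ M (f ⊛ g′) /z^ (M′ ℕ.+ (N ℕ.+ M))) i
    ≡⟨ cong₂ _+_ (mulZ^-pole M′ (f ⊛ g) (N ℕ.+ M) i)
         (trans (≗⇒≈ {mulZ^ M (f ⊛ g′)} (λ _ → refl) (trans (sym (poles N M M′)) (trans (cong (N ℕ.+_) (ℕ.+-comm M M′)) (poles N M′ M))) i)
                (mulZ^-pole M (f ⊛ g′) (N ℕ.+ M′) i)) ⟩
  coeff ((f ⊛ g) /z^ (N ℕ.+ M)) i + coeff ((f ⊛ g′) /z^ (N ℕ.+ M′)) i ∎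
  where
  poles : ∀ N M M′ → N ℕ.+ (M ℕ.+ M′) ≡ M′ ℕ.+ (N ℕ.+ M)
  poles N M M′ = trans (sym (ℕ.+-assoc N M M′)) (ℕ.+-comm (N ℕ.+ M) M′)
  ⊛-mulZ^ : ∀ K g → f ⊛ mulZ^ K g ≗ mulZ^ K (f ⊛ g)
  ⊛-mulZ^ zero    g n = refl
  ⊛-mulZ^ (suc K) g n = trans (⊛-mulZ f (mulZ^ K g) n) (mulZ-cong (⊛-mulZ^ K g) n)
  nums : f ⊛ (mulZ^ M′ g ⊕ mulZ^ M g′) ≗ mulZ^ M′ (f ⊛ g) ⊕ mulZ^ M (f ⊛ g′)
  nums n = trans (⊛-distribˡ-⊕ f (mulZ^ M′ g) (mulZ^ M g′) n) (cong₂ _+_ (⊛-mulZ^ M′ g n) (⊛-mulZ^ M g′ n))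

*ᴬ-∑ᴬ : ∀ a (xs : List J) F i → coeff (a *ᴬ ∑ᴬ xs F) i ≡ ∑ xs (λ s → coeff (a *ᴬ F s) i)
*ᴬ-∑ᴬ a@(f /z^ N) [] F i = coeff-zero (a *ᴬ 0ᴬ) (⊛-zeroʳ f const-0) i
*ᴬ-∑ᴬ a (s ∷ xs) F i = trans (*ᴬ-distribˡ-+ᴬ a (F s) (∑ᴬ xs F) i) (cong (coeff (a *ᴬ F s) i +_) (*ᴬ-∑ᴬ a xs F i))

-- `∂` is defined through the chosen pole; this description by coefficients alone shows that it
-- respects `≈`.
coeff-∂ : ∀ a i → coeff (∂ a) i ≡ fromℤ (ℤ.suc i) * coeff a (ℤ.suc i)
coeff-∂ (f /z^ N) i = begin
  coeff (∂ (f /z^ N)) i                        ≡⟨ coeff≡at _ (suc N) i ⟩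
  at ∂f (i ℤ.+ ℤ.+ suc N)                      ≡⟨ cong (at ∂f) (trans (shift i N) (sym (ℤ.+-assoc (ℤ.+ 1) i (ℤ.+ N)))) ⟩
  at ∂f (j ℤ.+ ℤ.+ N)                          ≡⟨ lemma (j ℤ.+ ℤ.+ N) refl ⟩
  fromℤ j * at f (j ℤ.+ ℤ.+ N)                 ≡⟨ cong (fromℤ j *_) (coeff≡at f N j) ⟨
  fromℤ j * coeff (f /z^ N) j                  ∎
  where
  j = ℤ.suc i
  ∂f = num (∂ (f /z^ N))
  lemma : ∀ k → k ≡ j ℤ.+ ℤ.+ N → at ∂f k ≡ fromℤ j * at f k
  lemma (ℤ.+ n) eq = cong (λ l → fromℤ l * f n) (trans (cong (ℤ._- ℤ.+ N) eq) (trans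
    (ℤ.+-assoc j (ℤ.+ N) (ℤ.- ℤ.+ N)) (trans (cong (ℤ._+_ j) (ℤ.+-inverseʳ (ℤ.+ N))) (ℤ.+-identityʳ j))))
  lemma ℤ.-[1+ _ ] eq = sym (*-zeroʳ (fromℤ j))

∂-cong : a ≈ b → ∂ a ≈ ∂ b
∂-cong {a} {b} a≈b i = trans (coeff-∂ a i) (trans (cong (fromℤ (ℤ.suc i) *_) (a≈b (ℤ.suc i))) (sym (coeff-∂ b i)))

∂-∑ᴬ : ∀ (xs : List J) F i → coeff (∂ (∑ᴬ xs F)) i ≡ ∑ xs (λ s → coeff (∂ (F s)) i)
∂-∑ᴬ xs F i = begin
  coeff (∂ (∑ᴬ xs F)) i                                          ≡⟨ coeff-∂ (∑ᴬ xs F) i ⟩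
  fromℤ (ℤ.suc i) * coeff (∑ᴬ xs F) (ℤ.suc i)                    ≡⟨ cong (fromℤ (ℤ.suc i) *_) (coeff-∑ᴬ xs F (ℤ.suc i)) ⟩
  fromℤ (ℤ.suc i) * ∑ xs (λ s → coeff (F s) (ℤ.suc i))           ≡⟨ ∑-*ˡ xs (fromℤ (ℤ.suc i)) (λ s → coeff (F s) (ℤ.suc i)) ⟨
  ∑ xs (λ s → fromℤ (ℤ.suc i) * coeff (F s) (ℤ.suc i))           ≡⟨ ∑-cong xs (λ s → coeff-∂ (F s) i) ⟨
  ∑ xs (λ s → coeff (∂ (F s)) i)                                 ∎

-- The exponent p + q - (N + M) of a product term is the sum of the exponents p - N and q - M of its
-- factors.
∂-*ᴬ : ∀ a b i → coeff (∂ (a *ᴬ b)) i ≡ coeff (∂ a *ᴬ b) i + coeff (a *ᴬ ∂ b) i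
∂-*ᴬ (f /z^ N) (g /z^ M) i = begin
  coeff (∂ ((f ⊛ g) /z^ (N ℕ.+ M))) i
    ≡⟨ ≗⇒≈ nums refl i ⟩
  coeff ((∂f ⊛ g ⊕ f ⊛ ∂g) /z^ suc (N ℕ.+ M)) i
    ≡⟨ coeff-⊕ (∂f ⊛ g) (f ⊛ ∂g) (suc (N ℕ.+ M)) i ⟩
  coeff ((∂f ⊛ g) /z^ suc (N ℕ.+ M)) i + coeff ((f ⊛ ∂g) /z^ suc (N ℕ.+ M)) i
    ≡⟨ cong (_+_ (coeff ((∂f ⊛ g) /z^ suc (N ℕ.+ M)) i)) (≗⇒≈ {f ⊛ ∂g} (λ _ → refl) (sym (ℕ.+-suc N M)) i) ⟩
  coeff ((∂f ⊛ g) /z^ (suc N ℕ.+ M)) i + coeff ((f ⊛ ∂g) /z^ (N ℕ.+ suc M)) i ∎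
  where
  ∂f = num (∂ (f /z^ N))
  ∂g = num (∂ (g /z^ M))
  weights : ∀ p q → fromℤ (ℤ.+ (p ℕ.+ q) ℤ.- ℤ.+ (N ℕ.+ M)) ≡ fromℤ (ℤ.+ p ℤ.- ℤ.+ N) + fromℤ (ℤ.+ q ℤ.- ℤ.+ M)
  weights p q = trans (cong fromℤ {ℤ.+ (p ℕ.+ q) ℤ.- ℤ.+ (N ℕ.+ M)} (begin
    ℤ.+ (p ℕ.+ q) ℤ.- ℤ.+ (N ℕ.+ M)
      ≡⟨ cong₂ ℤ._-_ (ℤ.pos-+ p q) (ℤ.pos-+ N M) ⟩
    (ℤ.+ p ℤ.+ ℤ.+ q) ℤ.- (ℤ.+ N ℤ.+ ℤ.+ M)
      ≡⟨ ℤsolve ⟩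
    (ℤ.+ p ℤ.- ℤ.+ N) ℤ.+ (ℤ.+ q ℤ.- ℤ.+ M) ∎)) (fromℤ-+ (ℤ.+ p ℤ.- ℤ.+ N) (ℤ.+ q ℤ.- ℤ.+ M))
    where
    ℤsolve = ℤS.solve 4 (λ p q N M → ((p ℤS.:+ q) ℤS.:- (N ℤS.:+ M)) ℤS.:=
      ((p ℤS.:- N) ℤS.:+ (q ℤS.:- M))) refl (ℤ.+ p) (ℤ.+ q) (ℤ.+ N) (ℤ.+ M)
  nums : num (∂ ((f ⊛ g) /z^ (N ℕ.+ M))) ≗ ∂f ⊛ g ⊕ f ⊛ ∂g
  nums n = begin
    w * (f ⊛ g) n
      ≡⟨ cong (w *_) (⊛≡conv f g n) ⟩
    w * conv n (λ p q → f p * g q)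
      ≡⟨ conv-*ˡ n w _ ⟨
    conv n (λ p q → w * (f p * g q))
      ≡⟨ conv-cong n (λ p q p+q≡n → trans
           (cong (_* (f p * g q)) (trans (cong (λ n → fromℤ (ℤ.+ n ℤ.- ℤ.+ (N ℕ.+ M))) (sym p+q≡n)) (weights p q)))
           (solve 4 (λ u v F G → (u :+ v) :* (F :* G) := u :* F :* G :+ F :* (v :* G)) refl
              (fromℤ (ℤ.+ p ℤ.- ℤ.+ N)) (fromℤ (ℤ.+ q ℤ.- ℤ.+ M)) (f p) (g q))) ⟩
    conv n (λ p q → ∂f p * g q + f p * ∂g q)
      ≡⟨ conv-+ n _ _ ⟩
    conv n (λ p q → ∂f p * g q) + conv n (λ p q → f p * ∂g q)
      ≡⟨ cong₂ _+_ (⊛≡conv ∂f g n) (⊛≡conv f ∂g n) ⟨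
    (∂f ⊛ g) n + (f ⊛ ∂g) n ∎
    where w = fromℤ (ℤ.+ n ℤ.- ℤ.+ (N ℕ.+ M))


𝒜₋-num : ∀ {f N} → 𝒜₋ (f /z^ N) → ∀ n → N ≤ n → f n ≡ 0ℚ
𝒜₋-num {f} {N} f∈ n N≤n = trans (sym (coeff-num f N n)) (f∈ (ℤ.+ n ℤ.- ℤ.+ N)
  (ℤ.i≤j⇒0≤j-i (ℤ.+≤+ N≤n)))

-- If p + q ≥ N + M, then p ≥ N or q ≥ M, so one of the two factors of each term has a nonnegative
-- exponent and vanishes.
𝒜₋-* : 𝒜₋ a → 𝒜₋ b → 𝒜₋ (a *ᴬ b)
𝒜₋-* {f /z^ N} {g /z^ M} f∈ g∈ (ℤ.+ i) 0≤i = trans (⊛≡conv f g (i ℕ.+ (N ℕ.+ M)))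
  (trans (conv-cong (i ℕ.+ (N ℕ.+ M)) term) (conv-0 (i ℕ.+ (N ℕ.+ M))))
  where
  term : ∀ p q → p ℕ.+ q ≡ i ℕ.+ (N ℕ.+ M) → f p * g q ≡ 0ℚ
  term p q p+q≡ with N ℕ.≤? p | M ℕ.≤? q
  ... | yes N≤p | _       = trans (cong (_* g q) (𝒜₋-num {f} {N} f∈ p N≤p)) (*-zeroˡ (g q))
  ... | no  _   | yes M≤q = trans (cong (f p *_) (𝒜₋-num {g} {M} g∈ q M≤q)) (*-zeroʳ (f p))
  ... | no  N≰p | no  M≰q = ⊥-elim (ℕ.<-irrefl p+q≡
    (ℕ.<-≤-trans (ℕ.+-mono-< (ℕ.≰⇒> N≰p) (ℕ.≰⇒> M≰q)) (ℕ.m≤n+m (N ℕ.+ M) i)))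

-- The Birkhoff decomposition

-_/z : 𝒜 → 𝒜
- (f /z^ N) /z = (λ n → - f n) /z^ suc N

χ : Word → 𝒜
χ []      = 1ᴬ
χ (d ∷ w) = ∂ (χ w)
χ (y ∷ w) = - χ w /z

-- The starting series is an argument so that a word can be evaluated block by block from its right
-- end.
ψ : Word → Series → Series
ψ []      f = f
ψ (d ∷ w) f = δ (ψ w f)
ψ (y ∷ w) f = h ⊛ ψ w f

ψ₁ : Word → 𝒜
ψ₁ w = ι (ψ w (const 1ℚ))

∂-ι : ∀ f → ∂ (ι f) ≈ ι (δ f)
∂-ι f i = trans (≗⇒≈ nums refl i) (mulZ-pole (δ f) 0 i)
  where
  nums : num (∂ (ι f)) ≗ mulZ (δ f)
  nums zero    = *-zeroˡ (f 0)
  nums (suc n) = cong (λ m → fromℕ m * f (suc n)) (ℕ.+-identityʳ (suc n))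

-- From x = -1/z + h: the polar summand is given to the left factor and the holomorphic one to the
-- right. This is the counterpart for `y` of the Leibniz rule for `d`.
x-*ᴬ : ∀ a p i → coeff (x *ᴬ (a *ᴬ ι p)) i ≡ coeff (- a /z *ᴬ ι p) i + coeff (a *ᴬ ι (h ⊛ p)) i
x-*ᴬ (b /z^ N) p i = begin
  coeff (((λ n → - (exp ⊛ I) n) ⊛ (b ⊛ p)) /z^ suc (N ℕ.+ 0)) i
    ≡⟨ ≗⇒≈ nums refl i ⟩
  coeff (((λ n → - b n) ⊛ p ⊕ mulZ (b ⊛ (h ⊛ p))) /z^ suc (N ℕ.+ 0)) i
    ≡⟨ coeff-⊕ ((λ n → - b n) ⊛ p) (mulZ (b ⊛ (h ⊛ p))) (suc (N ℕ.+ 0)) i ⟩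
  coeff (((λ n → - b n) ⊛ p) /z^ suc (N ℕ.+ 0)) i + coeff (mulZ (b ⊛ (h ⊛ p)) /z^ suc (N ℕ.+ 0)) i
    ≡⟨ cong (_+_ (coeff (((λ n → - b n) ⊛ p) /z^ suc (N ℕ.+ 0)) i)) (mulZ-pole (b ⊛ (h ⊛ p)) (N ℕ.+ 0) i) ⟩
  coeff (((λ n → - b n) ⊛ p) /z^ suc (N ℕ.+ 0)) i + coeff ((b ⊛ (h ⊛ p)) /z^ (N ℕ.+ 0)) i ∎
  where
  const-neg : const (- 1ℚ) ≗ (λ n → - const 1ℚ n)
  const-neg zero    = refl
  const-neg (suc n) = refl
  neg : const (- 1ℚ) ⊛ (b ⊛ p) ≗ (λ n → - b n) ⊛ p
  neg n = begin
    (const (- 1ℚ) ⊛ (b ⊛ p)) n        ≡⟨ ⊛-congˡ (b ⊛ p) const-neg n ⟩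
    ((λ n → - const 1ℚ n) ⊛ (b ⊛ p)) n ≡⟨ ⊛-negˡ (const 1ℚ) (b ⊛ p) n ⟩
    - (const 1ℚ ⊛ (b ⊛ p)) n          ≡⟨ cong -_ (⊛-identityˡ (b ⊛ p) n) ⟩
    - (b ⊛ p) n                       ≡⟨ ⊛-negˡ b p n ⟨
    ((λ n → - b n) ⊛ p) n             ∎
  swap : h ⊛ (b ⊛ p) ≗ b ⊛ (h ⊛ p)
  swap n = trans (sym (⊛-assoc h b p n)) (trans (⊛-congˡ p (⊛-comm h b) n) (⊛-assoc b h p n))
  nums : (λ n → - (exp ⊛ I) n) ⊛ (b ⊛ p) ≗ (λ n → - b n) ⊛ p ⊕ mulZ (b ⊛ (h ⊛ p))
  nums n = begin
    ((λ n → - (exp ⊛ I) n) ⊛ (b ⊛ p)) n                     ≡⟨ ⊛-congˡ (b ⊛ p) -exp-⊛-I n ⟩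
    ((const (- 1ℚ) ⊕ mulZ h) ⊛ (b ⊛ p)) n                   ≡⟨ ⊛-distribʳ-⊕ (b ⊛ p) (const (- 1ℚ)) (mulZ h) n ⟩
    (const (- 1ℚ) ⊛ (b ⊛ p)) n + (mulZ h ⊛ (b ⊛ p)) n       ≡⟨ cong₂ _+_ (neg n) (trans (mulZ-⊛ h (b ⊛ p) n) (mulZ-cong swap n)) ⟩
    ((λ n → - b n) ⊛ p) n + mulZ (b ⊛ (h ⊛ p)) n            ∎

-- Factorization of the character over subsets of letters

∑-splits : ∀ l w (F : Word × Word → ℚ) → ∑ (splits (l ∷ w)) F ≡
  ∑ (splits w) (λ (u , v) → F (l ∷ u , v)) + ∑ (splits w) (λ (u , v) → F (u , l ∷ v))
∑-splits l w F = trans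
  (∑-++ (map (λ (u , v) → (l ∷ u , v)) (splits w)) (map (λ (u , v) → (u , l ∷ v)) (splits w)) F)
  (cong₂ _+_ (∑-map (λ (u , v) → (l ∷ u , v)) (splits w) F) (∑-map (λ (u , v) → (u , l ∷ v)) (splits w) F))

-- The induction runs over all of `splits`, whose recursion sends the first letter to either side.
-- The filter in `Δ₀` would not fit it: prefixing `d` to the empty word leaves Y.
φʷ≈χ⋆ψ : ∀ w i → coeff (φʷ w) i ≡ ∑ (splits w) (λ (u , v) → coeff (χ u *ᴬ ψ₁ v) i)
φʷ≈χ⋆ψ [] i = sym (trans (+-identityʳ (coeff (1ᴬ *ᴬ 1ᴬ) i)) (*ᴬ-identityʳ 1ᴬ i))
φʷ≈χ⋆ψ (d ∷ w) i = begin
  coeff (∂ (φʷ w)) i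
    ≡⟨ ∂-cong {φʷ w} {∑ᴬ (splits w) F} (λ i → trans (φʷ≈χ⋆ψ w i) (sym (coeff-∑ᴬ (splits w) F i))) i ⟩
  coeff (∂ (∑ᴬ (splits w) F)) i
    ≡⟨ ∂-∑ᴬ (splits w) F i ⟩
  ∑ (splits w) (λ s → coeff (∂ (F s)) i)
    ≡⟨ ∑-cong (splits w) (λ (u , v) → trans (∂-*ᴬ (χ u) (ψ₁ v) i)
         (cong (_+_ (coeff (∂ (χ u) *ᴬ ψ₁ v) i)) (*ᴬ-cong {χ u} {χ u} {∂ (ψ₁ v)} (λ _ → refl) (∂-ι (ψ v (const 1ℚ))) i))) ⟩
  ∑ (splits w) (λ (u , v) → coeff (χ (d ∷ u) *ᴬ ψ₁ v) i + coeff (χ u *ᴬ ψ₁ (d ∷ v)) i)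
    ≡⟨ ∑-+ (splits w) (λ (u , v) → coeff (χ (d ∷ u) *ᴬ ψ₁ v) i) (λ (u , v) → coeff (χ u *ᴬ ψ₁ (d ∷ v)) i) ⟩
  ∑ (splits w) (λ (u , v) → coeff (χ (d ∷ u) *ᴬ ψ₁ v) i) + ∑ (splits w) (λ (u , v) → coeff (χ u *ᴬ ψ₁ (d ∷ v)) i)
    ≡⟨ ∑-splits d w (λ (u , v) → coeff (χ u *ᴬ ψ₁ v) i) ⟨
  ∑ (splits (d ∷ w)) (λ (u , v) → coeff (χ u *ᴬ ψ₁ v) i) ∎
  where
  F : Word × Word → 𝒜
  F (u , v) = χ u *ᴬ ψ₁ v
φʷ≈χ⋆ψ (y ∷ w) i = begin
  coeff (x *ᴬ φʷ w) i
    ≡⟨ *ᴬ-cong {x} {x} {φʷ w} {∑ᴬ (splits w) F} (λ _ → refl) (λ i → trans (φʷ≈χ⋆ψ w i) (sym (coeff-∑ᴬ (splits w) F i))) i ⟩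
  coeff (x *ᴬ ∑ᴬ (splits w) F) i
    ≡⟨ *ᴬ-∑ᴬ x (splits w) F i ⟩
  ∑ (splits w) (λ s → coeff (x *ᴬ F s) i)
    ≡⟨ ∑-cong (splits w) (λ (u , v) → x-*ᴬ (χ u) (ψ v (const 1ℚ)) i) ⟩
  ∑ (splits w) (λ (u , v) → coeff (χ (y ∷ u) *ᴬ ψ₁ v) i + coeff (χ u *ᴬ ψ₁ (y ∷ v)) i)
    ≡⟨ ∑-+ (splits w) (λ (u , v) → coeff (χ (y ∷ u) *ᴬ ψ₁ v) i) (λ (u , v) → coeff (χ u *ᴬ ψ₁ (y ∷ v)) i) ⟩
  ∑ (splits w) (λ (u , v) → coeff (χ (y ∷ u) *ᴬ ψ₁ v) i) + ∑ (splits w) (λ (u , v) → coeff (χ u *ᴬ ψ₁ (y ∷ v)) i)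
    ≡⟨ ∑-splits y w (λ (u , v) → coeff (χ u *ᴬ ψ₁ v) i) ⟨
  ∑ (splits (y ∷ w)) (λ (u , v) → coeff (χ u *ᴬ ψ₁ v) i) ∎
  where
  F : Word × Word → 𝒜
  F (u , v) = χ u *ᴬ ψ₁ v

inY-∷ : ∀ l m w → inY (l ∷ m ∷ w) ≡ inY (m ∷ w)
inY-∷ d m w = refl
inY-∷ y m w = refl

-- A word outside Y ends in `d`, which acts first and kills the constant 1.
χ-∉Y : ∀ w → inY w ≡ false → ∀ n → num (χ w) n ≡ 0ℚ
χ-∉Y (d ∷ [])    _  zero    = refl
χ-∉Y (d ∷ [])    _  (suc n) = *-zeroʳ (fromℤ (ℤ.+ suc n ℤ.- ℤ.+ 0))
χ-∉Y (d ∷ m ∷ w) ∉Y n = trans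
  (cong (fromℤ (ℤ.+ n ℤ.- ℤ.+ pole (χ (m ∷ w))) *_) (χ-∉Y (m ∷ w) ∉Y n))
  (*-zeroʳ (fromℤ (ℤ.+ n ℤ.- ℤ.+ pole (χ (m ∷ w)))))
χ-∉Y (y ∷ m ∷ w) ∉Y n = cong -_ (χ-∉Y (m ∷ w) ∉Y n)

ψ-∉Y : ∀ w → inY w ≡ false → ∀ n → ψ w (const 1ℚ) n ≡ 0ℚ
ψ-∉Y (d ∷ [])    _  n = *-zeroʳ (fromℕ (suc n))
ψ-∉Y (d ∷ m ∷ w) ∉Y n = trans (cong (fromℕ (suc n) *_) (ψ-∉Y (m ∷ w) ∉Y (suc n))) (*-zeroʳ (fromℕ (suc n)))
ψ-∉Y (y ∷ m ∷ w) ∉Y n = ⊛-zeroʳ h (ψ-∉Y (m ∷ w) ∉Y) n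

φʷ≈χ⋆ψ-Δ₀ : ∀ w i → coeff (φʷ w) i ≡ ∑ (Δ₀ w) (λ (u , v) → coeff (χ u *ᴬ ψ₁ v) i)
φʷ≈χ⋆ψ-Δ₀ w i = begin
  coeff (φʷ w) i
    ≡⟨ φʷ≈χ⋆ψ w i ⟩
  ∑ (splits w) (λ (u , v) → coeff (χ u *ᴬ ψ₁ v) i)
    ≡⟨ ∑-cong (splits w) (λ (u , v) → vanish u v _ refl _ refl) ⟩
  ∑ (splits w) (λ (u , v) → if inY u ∧ inY v then coeff (χ u *ᴬ ψ₁ v) i else 0ℚ)
    ≡⟨ ∑-filter (T? ∘ λ (u , v) → inY u ∧ inY v) (splits w) (λ (u , v) → coeff (χ u *ᴬ ψ₁ v) i) ⟨
  ∑ (Δ₀ w) (λ (u , v) → coeff (χ u *ᴬ ψ₁ v) i) ∎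
  where
  -- The truth values are variables tied by equations, so that splitting on them also decides the
  -- conditional.
  vanish : ∀ u v b → inY u ≡ b → ∀ b′ → inY v ≡ b′ →
    coeff (χ u *ᴬ ψ₁ v) i ≡ (if b ∧ b′ then coeff (χ u *ᴬ ψ₁ v) i else 0ℚ)
  vanish u v true  _  true  _  = refl
  vanish u v true  _  false ∉Y = coeff-zero (χ u *ᴬ ψ₁ v) (⊛-zeroʳ (num (χ u)) (ψ-∉Y v ∉Y)) i
  vanish u v false ∉Y _     _  = coeff-zero (χ u *ᴬ ψ₁ v) (⊛-zeroˡ (ψ v (const 1ℚ)) (χ-∉Y u ∉Y)) i

coeff-/z : ∀ a i → coeff (- a /z) i ≡ - coeff a (ℤ.suc i)
coeff-/z (f /z^ N) i = begin
  coeff ((λ n → - f n) /z^ suc N) i              ≡⟨ coeff≡at (λ n → - f n) (suc N) i ⟩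
  at (λ n → - f n) (i ℤ.+ ℤ.+ suc N)             ≡⟨ cong (at (λ n → - f n)) (trans (shift i N) (sym (ℤ.+-assoc (ℤ.+ 1) i (ℤ.+ N)))) ⟩
  at (λ n → - f n) (ℤ.suc i ℤ.+ ℤ.+ N)           ≡⟨ at-neg (ℤ.suc i ℤ.+ ℤ.+ N) ⟩
  - at f (ℤ.suc i ℤ.+ ℤ.+ N)                     ≡⟨ cong -_ (coeff≡at f N (ℤ.suc i)) ⟨
  - coeff (f /z^ N) (ℤ.suc i)                    ∎
  where
  at-neg : ∀ i → at (λ n → - f n) i ≡ - at f i
  at-neg (ℤ.+ n)    = refl
  at-neg ℤ.-[1+ _ ] = refl

-- Both letters lower exponents by one, and so they carry ℚ ⊕ 𝒜₋ into 𝒜₋; the exponent 0 becomes -1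
-- or is killed by the derivative.
χ∈𝒜₋   : ∀ l w → 𝒜₋ (χ (l ∷ w))
χ∈ℚ⊕𝒜₋ : ∀ w → ℚ⊕𝒜₋ (χ w)

χ∈𝒜₋ d w i 0≤i = trans (coeff-∂ (χ w) i) (trans
  (cong (fromℤ (ℤ.suc i) *_) (χ∈ℚ⊕𝒜₋ w (ℤ.suc i) (ℤ.≤-<-trans 0≤i (ℤ.suc[i]≤j⇒i<j ℤ.≤-refl))))
  (*-zeroʳ (fromℤ (ℤ.suc i))))
χ∈𝒜₋ y w i 0≤i = trans (coeff-/z (χ w) i) (cong -_ (χ∈ℚ⊕𝒜₋ w (ℤ.suc i) (ℤ.≤-<-trans 0≤i (ℤ.suc[i]≤j⇒i<j ℤ.≤-refl))))

χ∈ℚ⊕𝒜₋ []      (ℤ.+ suc n) _   = refl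
χ∈ℚ⊕𝒜₋ []      (ℤ.+ 0) (ℤ.+<+ ())
χ∈ℚ⊕𝒜₋ (l ∷ w) i           0<i = χ∈𝒜₋ l w i (ℤ.<⇒≤ 0<i)

-- Comparison with a Birkhoff decomposition by induction on word length

Smaller : ℕ → Word → Set
Smaller n w = w ≢ [] × length w ℕ.< n

Middle : ℕ → Word × Word → Set
Middle n (u , v) = Smaller n u × Smaller n v

-- Isolates the two trivial splits; in all others both parts are nonempty and hence shorter, as the
-- induction requires.
splits-ends : ∀ l w → ∃ λ m → All (Middle (suc (length w))) m ×
  splits (l ∷ w) ≡ (l ∷ w , []) ∷ m ++ [ ([] , l ∷ w) ]
splits-ends l []       = [] , [] , refl
splits-ends l (l′ ∷ w) with splits-ends l′ w
... | m , m-middle , eq = m′ , m′-middle , eq′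
  where
  left right : Word × Word → Word × Word
  left  (u , v) = l ∷ u , v
  right (u , v) = u , l ∷ v
  m′ : List (Word × Word)
  -- The two pairs between the images of m come from the trivial splits of the shorter word, when
  -- `l` joins the empty part.
  m′ = map left m ++ (l ∷ [] , l′ ∷ w) ∷ (l′ ∷ w , l ∷ []) ∷ map right m
  weaken : ∀ {u} → Smaller (suc (length w)) u → Smaller (suc (suc (length w))) u
  weaken (u≢[] , u<) = u≢[] , ℕ.m<n⇒m<1+n u<
  extend : ∀ {u} → Smaller (suc (length w)) u → Smaller (suc (suc (length w))) (l ∷ u)
  extend (_ , u<) = (λ ()) , s≤s u<
  m′-middle : All (Middle (suc (suc (length w)))) m′
  m′-middle = All.++⁺ (All.map⁺ (All.map (λ (u< , v<) → extend u< , weaken v<) m-middle))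
    ((((λ ()) , s≤s (s≤s z≤n)) , ((λ ()) , ℕ.≤-refl)) ∷
     (((λ ()) , ℕ.≤-refl) , ((λ ()) , s≤s (s≤s z≤n))) ∷
     All.map⁺ (All.map (λ (u< , v<) → weaken u< , extend v<) m-middle))
  eq′ : splits (l ∷ l′ ∷ w) ≡ (l ∷ l′ ∷ w , []) ∷ m′ ++ [ ([] , l ∷ l′ ∷ w) ]
  eq′ = begin
    map left (splits (l′ ∷ w)) ++ map right (splits (l′ ∷ w))
      ≡⟨ cong (λ s → map left s ++ map right s) eq ⟩
    (l ∷ l′ ∷ w , []) ∷ map left (m ++ [ ([] , l′ ∷ w) ]) ++ (l′ ∷ w , l ∷ []) ∷ map right (m ++ [ ([] , l′ ∷ w) ])
      ≡⟨ cong₂ (λ a b → (l ∷ l′ ∷ w , []) ∷ a ++ (l′ ∷ w , l ∷ []) ∷ b)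
           (List.map-++ left m [ ([] , l′ ∷ w) ]) (List.map-++ right m [ ([] , l′ ∷ w) ]) ⟩
    (l ∷ l′ ∷ w , []) ∷ (map left m ++ [ (l ∷ [] , l′ ∷ w) ]) ++ (l′ ∷ w , l ∷ []) ∷ map right m ++ [ ([] , l ∷ l′ ∷ w) ]
      ≡⟨ cong ((l ∷ l′ ∷ w , []) ∷_) (trans (List.++-assoc (map left m) [ (l ∷ [] , l′ ∷ w) ] _)
           (sym (List.++-assoc (map left m) ((l ∷ [] , l′ ∷ w) ∷ (l′ ∷ w , l ∷ []) ∷ map right m) [ ([] , l ∷ l′ ∷ w) ]))) ⟩
    (l ∷ l′ ∷ w , []) ∷ m′ ++ [ ([] , l ∷ l′ ∷ w) ] ∎

In : Word × Word → Set
In (u , v) = inY u ≡ true × inY v ≡ true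

-- Here m lists the reduced coproduct. The two trivial terms survive the filter because the word
-- lies in Y.
Δ₀-ends : ∀ l w → inY (l ∷ w) ≡ true →
  ∃ λ m → All (λ s → Middle (suc (length w)) s × In s) m ×
    (∀ (F : Word × Word → ℚ) → ∑ (Δ₀ (l ∷ w)) F ≡ F (l ∷ w , []) + (∑ m F + F ([] , l ∷ w)))
Δ₀-ends l w ∈Y with splits-ends l w
... | m , m-middle , eq = filterᵇ P m , All.zip (All.filter⁺ P? m-middle , All.map (λ {s} → in-Y s) (All.all-filter P? m)) , sums
  where
  P : Word × Word → Bool
  P (u , v) = inY u ∧ inY v
  P? = T? ∘ P
  in-Y : ∀ s → Data.Bool.T (P s) → In s
  in-Y (u , v) t with inY u | inY v
  ... | true | true = refl , refl
  P-first : P (l ∷ w , []) ≡ true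
  P-first = cong (_∧ true) ∈Y
  sums : ∀ F → ∑ (Δ₀ (l ∷ w)) F ≡ F (l ∷ w , []) + (∑ (filterᵇ P m) F + F ([] , l ∷ w))
  sums F = begin
    ∑ (filterᵇ P (splits (l ∷ w))) F
      ≡⟨ trans (cong (λ s → ∑ (filterᵇ P s) F) eq) (∑-filter P? ((l ∷ w , []) ∷ m ++ [ ([] , l ∷ w) ]) F) ⟩
    G (l ∷ w , []) + ∑ (m ++ [ ([] , l ∷ w) ]) G
      ≡⟨ cong (_+_ (G (l ∷ w , []))) (∑-++ m [ ([] , l ∷ w) ] G) ⟩
    G (l ∷ w , []) + (∑ m G + (G ([] , l ∷ w) + 0ℚ))
      ≡⟨ cong₂ (λ a b → a + (∑ m G + b))
           (cong (λ b → if b then F (l ∷ w , []) else 0ℚ) P-first)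
           (trans (+-identityʳ (G ([] , l ∷ w))) (cong (λ b → if b then F ([] , l ∷ w) else 0ℚ) ∈Y)) ⟩
    F (l ∷ w , []) + (∑ m G + F ([] , l ∷ w))
      ≡⟨ cong (λ s → F (l ∷ w , []) + (s + F ([] , l ∷ w))) (∑-filter P? m F) ⟨
    F (l ∷ w , []) + (∑ (filterᵇ P m) F + F ([] , l ∷ w)) ∎
    where
    G : Word × Word → ℚ
    G s = if P s then F s else 0ℚ

linear-⟨⟩ : ∀ F w → linear F ⟨ w ⟩ ≈ F w
linear-⟨⟩ F w i = trans (coeff-+ᴬ (1ℚ ·ᴬ F w) 0ᴬ i) (trans
  (cong₂ _+_ (trans (coeff-· 1ℚ (F w) i) (*-identityˡ (coeff (F w) i))) (coeff-0ᴬ i))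
  (+-identityʳ (coeff (F w) i)))

coeff-⋆ : ∀ α β w i → coeff ((α ⋆ β) ⟨ w ⟩) i ≡ ∑ (Δ₀ w) (λ (u , v) → coeff (α ⟨ u ⟩ *ᴬ β ⟨ v ⟩) i)
coeff-⋆ α β w i = trans (linear-⟨⟩ (λ w → ∑ᴬ (Δ₀ w) λ (u , v) → α ⟨ u ⟩ *ᴬ β ⟨ v ⟩) w i)
  (coeff-∑ᴬ (Δ₀ w) (λ (u , v) → α ⟨ u ⟩ *ᴬ β ⟨ v ⟩) i)

module _ (Birkhoff : BirkhoffDecomposition) where
  open BirkhoffDecomposition Birkhoff

  -- On a nonempty word `φ₋⁻¹ ⋆ φ₋` vanishes, which expresses `φ₋⁻¹` through values of `φ₋` on
  -- nonempty words and products of such values with earlier ones of `φ₋⁻¹`; 𝒜₋ is closed under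
  -- products.
  φ₋⁻¹∈𝒜₋ : ∀ n w → Smaller n w → inY w ≡ true → 𝒜₋ (φ₋⁻¹ ⟨ w ⟩)
  φ₋⁻¹∈𝒜₋ n       []      ([]≢[] , _)        _  = ⊥-elim ([]≢[] refl)
  φ₋⁻¹∈𝒜₋ (suc n) (l ∷ w) (_ , s≤s w<n) ∈Y i 0≤i with Δ₀-ends l w ∈Y
  ... | m , m-middle , sums = begin
    coeff (φ₋⁻¹ ⟨ l ∷ w ⟩) i
      ≡⟨ trans (sym (+-identityʳ _)) (cong₂ _+_
           (sym (trans (*ᴬ-cong {φ₋⁻¹ ⟨ l ∷ w ⟩} {φ₋⁻¹ ⟨ l ∷ w ⟩} {φ₋ ⟨ [] ⟩} {1ᴬ} (λ _ → refl) φ₋-unit i) (*ᴬ-identityʳ (φ₋⁻¹ ⟨ l ∷ w ⟩) i)))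
           (sym (cong₂ _+_ middle≡0 last≡0))) ⟩
    F (l ∷ w , []) + (∑ m F + F ([] , l ∷ w))
      ≡⟨ sums F ⟨
    ∑ (Δ₀ (l ∷ w)) F
      ≡⟨ coeff-⋆ φ₋⁻¹ φ₋ (l ∷ w) i ⟨
    coeff ((φ₋⁻¹ ⋆ φ₋) ⟨ l ∷ w ⟩) i
      ≡⟨ (inverseˡ ⟨ l ∷ w ⟩ i) ⟩
    coeff (0ℚ ·ᴬ 1ᴬ) i
      ≡⟨ trans (coeff-· 0ℚ 1ᴬ i) (*-zeroˡ (coeff 1ᴬ i)) ⟩
    0ℚ ∎
    where
    F : Word × Word → ℚ
    F (u , v) = coeff (φ₋⁻¹ ⟨ u ⟩ *ᴬ φ₋ ⟨ v ⟩) i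
    φ₋∈𝒜₋ : ∀ w → w ≢ [] → 𝒜₋ (φ₋ ⟨ w ⟩)
    φ₋∈𝒜₋ []      []≢[] = ⊥-elim ([]≢[] refl)
    φ₋∈𝒜₋ (l ∷ w) _     = φ₋-kerε ⟨ l ∷ w ⟩ refl
    middle≡0 : ∑ m F ≡ 0ℚ
    middle≡0 = trans (∑-cong-All (All.map
      (λ { {u , v} (((u≢ , u<) , (v≢ , _)) , (u∈Y , _)) →
           𝒜₋-* {φ₋⁻¹ ⟨ u ⟩} {φ₋ ⟨ v ⟩} (φ₋⁻¹∈𝒜₋ n u (u≢ , ℕ.<-≤-trans u< w<n) u∈Y) (φ₋∈𝒜₋ v v≢) i 0≤i })
      m-middle)) (∑-0 m)
    last≡0 : F ([] , l ∷ w) ≡ 0ℚ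
    last≡0 = trans (*ᴬ-congˡ {φ₋⁻¹ ⟨ [] ⟩} {1ᴬ} (φ₋ ⟨ l ∷ w ⟩) φ₋⁻¹-unit i) (trans
      (*ᴬ-identityˡ (φ₋ ⟨ l ∷ w ⟩) i) (φ₋∈𝒜₋ (l ∷ w) (λ ()) i 0≤i))

  φ₊-unit : φ₊ ⟨ [] ⟩ ≈ 1ᴬ
  φ₊-unit i = begin
    coeff (φ₊ ⟨ [] ⟩) i                     ≡⟨ *ᴬ-identityˡ (φ₊ ⟨ [] ⟩) i ⟨
    coeff (1ᴬ *ᴬ φ₊ ⟨ [] ⟩) i               ≡⟨ *ᴬ-congˡ {φ₋⁻¹ ⟨ [] ⟩} {1ᴬ} (φ₊ ⟨ [] ⟩) φ₋⁻¹-unit i ⟨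
    coeff (φ₋⁻¹ ⟨ [] ⟩ *ᴬ φ₊ ⟨ [] ⟩) i      ≡⟨ +-identityʳ _ ⟨
    coeff (φ₋⁻¹ ⟨ [] ⟩ *ᴬ φ₊ ⟨ [] ⟩) i + 0ℚ ≡⟨ coeff-⋆ φ₋⁻¹ φ₊ [] i ⟨
    coeff ((φ₋⁻¹ ⋆ φ₊) ⟨ [] ⟩) i            ≡⟨ (decompose ⟨ [] ⟩ i) ⟨
    coeff (φ ⟨ [] ⟩) i                      ≡⟨ linear-⟨⟩ φʷ [] i ⟩
    coeff 1ᴬ i                              ∎

  -- By induction the middle terms of both convolutions agree, so φ₋⁻¹ + φ₊ = χ + ψ on the word. At
  -- exponents ≥ 0 the polar members vanish on both sides, at exponents < 0 the holomorphic ones,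
  -- which separates the two equalities.
  uniqueness : ∀ n w → length w ℕ.< n → inY w ≡ true → (φ₋⁻¹ ⟨ w ⟩ ≈ χ w) × (φ₊ ⟨ w ⟩ ≈ ψ₁ w)
  uniqueness n       []      _         _ = φ₋⁻¹-unit , φ₊-unit
  uniqueness (suc n) (l ∷ w) (s≤s w<n) ∈Y with Δ₀-ends l w ∈Y
  ... | m , m-middle , sums = (λ i → proj₁ (cases i)) , (λ i → proj₂ (cases i))
    where
    F G : ℤ.ℤ → Word × Word → ℚ
    F i (u , v) = coeff (φ₋⁻¹ ⟨ u ⟩ *ᴬ φ₊ ⟨ v ⟩) i
    G i (u , v) = coeff (χ u *ᴬ ψ₁ v) i
    F≡G : ∀ i → ∑ m (F i) ≡ ∑ m (G i)
    F≡G i = ∑-cong-All (All.map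
      (λ { {u , v} (((_ , u<) , (_ , v<)) , (u∈Y , v∈Y)) →
           *ᴬ-cong {φ₋⁻¹ ⟨ u ⟩} {χ u} {φ₊ ⟨ v ⟩} {ψ₁ v}
             (proj₁ (uniqueness n u (ℕ.<-≤-trans u< w<n) u∈Y))
             (proj₂ (uniqueness n v (ℕ.<-≤-trans v< w<n) v∈Y)) i })
      m-middle)
    balance : ∀ i → coeff (φ₋⁻¹ ⟨ l ∷ w ⟩) i + coeff (φ₊ ⟨ l ∷ w ⟩) i ≡ coeff (χ (l ∷ w)) i + coeff (ψ₁ (l ∷ w)) i
    balance i = begin
      p + q                     ≡⟨ solve 3 (λ p q s → p :+ q := (p :+ (s :+ q)) :- s) refl p q (∑ m (F i)) ⟩
      p + (∑ m (F i) + q) - ∑ m (F i) ≡⟨ cong₂ _-_ eq (F≡G i) ⟩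
      p′ + (∑ m (G i) + q′) - ∑ m (G i) ≡⟨ solve 3 (λ p q s → p :+ q := (p :+ (s :+ q)) :- s) refl p′ q′ (∑ m (G i)) ⟨
      p′ + q′                   ∎
      where
      p  = coeff (φ₋⁻¹ ⟨ l ∷ w ⟩) i
      q  = coeff (φ₊ ⟨ l ∷ w ⟩) i
      p′ = coeff (χ (l ∷ w)) i
      q′ = coeff (ψ₁ (l ∷ w)) i
      first : F i (l ∷ w , []) ≡ p
      first = trans (*ᴬ-cong {φ₋⁻¹ ⟨ l ∷ w ⟩} {φ₋⁻¹ ⟨ l ∷ w ⟩} {φ₊ ⟨ [] ⟩} {1ᴬ} (λ _ → refl) φ₊-unit i)
        (*ᴬ-identityʳ (φ₋⁻¹ ⟨ l ∷ w ⟩) i)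
      last : F i ([] , l ∷ w) ≡ q
      last = trans (*ᴬ-congˡ {φ₋⁻¹ ⟨ [] ⟩} {1ᴬ} (φ₊ ⟨ l ∷ w ⟩) φ₋⁻¹-unit i) (*ᴬ-identityˡ (φ₊ ⟨ l ∷ w ⟩) i)
      eq : p + (∑ m (F i) + q) ≡ p′ + (∑ m (G i) + q′)
      eq = begin
        p + (∑ m (F i) + q)                                        ≡⟨ cong₂ (λ a b → a + (∑ m (F i) + b)) first last ⟨
        F i (l ∷ w , []) + (∑ m (F i) + F i ([] , l ∷ w))           ≡⟨ sums (F i) ⟨
        ∑ (Δ₀ (l ∷ w)) (F i)                                       ≡⟨ coeff-⋆ φ₋⁻¹ φ₊ (l ∷ w) i ⟨
        coeff ((φ₋⁻¹ ⋆ φ₊) ⟨ l ∷ w ⟩) i                            ≡⟨ (decompose ⟨ l ∷ w ⟩ i) ⟨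
        coeff (φ ⟨ l ∷ w ⟩) i                                      ≡⟨ linear-⟨⟩ φʷ (l ∷ w) i ⟩
        coeff (φʷ (l ∷ w)) i                                       ≡⟨ φʷ≈χ⋆ψ-Δ₀ (l ∷ w) i ⟩
        ∑ (Δ₀ (l ∷ w)) (G i)                                       ≡⟨ sums (G i) ⟩
        G i (l ∷ w , []) + (∑ m (G i) + G i ([] , l ∷ w))           ≡⟨ cong₂ (λ a b → a + (∑ m (G i) + b))
                                                                         (*ᴬ-identityʳ (χ (l ∷ w)) i) (*ᴬ-identityˡ (ψ₁ (l ∷ w)) i) ⟩
        p′ + (∑ m (G i) + q′)                                      ∎
    cases : ∀ i → (coeff (φ₋⁻¹ ⟨ l ∷ w ⟩) i ≡ coeff (χ (l ∷ w)) i) × (coeff (φ₊ ⟨ l ∷ w ⟩) i ≡ coeff (ψ₁ (l ∷ w)) i)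
    cases i@(ℤ.+ n′) = trans p≡0 (sym p′≡0) , (begin
      coeff (φ₊ ⟨ l ∷ w ⟩) i                             ≡⟨ +-identityˡ _ ⟨
      0ℚ + coeff (φ₊ ⟨ l ∷ w ⟩) i                        ≡⟨ cong (_+ coeff (φ₊ ⟨ l ∷ w ⟩) i) p≡0 ⟨
      coeff (φ₋⁻¹ ⟨ l ∷ w ⟩) i + coeff (φ₊ ⟨ l ∷ w ⟩) i  ≡⟨ balance i ⟩
      coeff (χ (l ∷ w)) i + coeff (ψ₁ (l ∷ w)) i         ≡⟨ cong (_+ coeff (ψ₁ (l ∷ w)) i) p′≡0 ⟩
      0ℚ + coeff (ψ₁ (l ∷ w)) i                          ≡⟨ +-identityˡ _ ⟩
      coeff (ψ₁ (l ∷ w)) i                               ∎)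
      where
      p≡0  = φ₋⁻¹∈𝒜₋ (suc n) (l ∷ w) ((λ ()) , s≤s w<n) ∈Y i (ℤ.+≤+ z≤n)
      p′≡0 = χ∈𝒜₋ l w i (ℤ.+≤+ z≤n)
    cases i@(ℤ.-[1+ k ]) = (begin
      coeff (φ₋⁻¹ ⟨ l ∷ w ⟩) i                           ≡⟨ +-identityʳ _ ⟨
      coeff (φ₋⁻¹ ⟨ l ∷ w ⟩) i + 0ℚ                      ≡⟨ cong (_+_ (coeff (φ₋⁻¹ ⟨ l ∷ w ⟩) i)) q≡0 ⟨
      coeff (φ₋⁻¹ ⟨ l ∷ w ⟩) i + coeff (φ₊ ⟨ l ∷ w ⟩) i  ≡⟨ balance i ⟩
      coeff (χ (l ∷ w)) i + 0ℚ                           ≡⟨ +-identityʳ _ ⟩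
      coeff (χ (l ∷ w)) i                                ∎) , q≡0
      where q≡0 = φ₊-range ⟨ l ∷ w ⟩ i ℤ.-<+

-- Renormalized values

ψ-++ : ∀ u v f → ψ (u ++ v) f ≡ ψ u (ψ v f)
ψ-++ []      v f = refl
ψ-++ (d ∷ u) v f = cong δ (ψ-++ u v f)
ψ-++ (y ∷ u) v f = cong (h ⊛_) (ψ-++ u v f)

ψ-cong : ∀ w → f ≗ g → ψ w f ≗ ψ w g
ψ-cong []      f≗g = f≗g
ψ-cong (d ∷ w) f≗g = δ-cong (ψ-cong w f≗g)
ψ-cong (y ∷ w) f≗g = ⊛-congʳ h (ψ-cong w f≗g)

δ-scale : ∀ s f → δ (λ n → s * f n) ≗ (λ n → s * δ f n)
δ-scale s f n = solve 3 (λ s N p → N :* (s :* p) := s :* (N :* p)) refl s (fromℕ (suc n)) (f (suc n))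

ψ-scale : ∀ w s f → ψ w (λ n → s * f n) ≗ (λ n → s * ψ w f n)
ψ-scale []      s f n = refl
ψ-scale (d ∷ w) s f n = trans (δ-cong (ψ-scale w s f) n) (δ-scale s (ψ w f) n)
ψ-scale (y ∷ w) s f n = trans (⊛-congʳ h (ψ-scale w s f) n) (⊛-scaleʳ s h (ψ w f) n)

-- Differentiating a series in -z costs a sign each time, and passing from δᵏ to `𝔇 k` costs k!.
-- Since the result is again a multiple of a series in -z, blocks can be chained.
ψ-block : ∀ k g → ψ (replicate k d ++ [ y ]) (sg g) ≗ (λ n → -1^ k * fromℕ (k !) * sg (𝔇 k (c ⊛ g)) n)
ψ-block zero    g n = begin
  (h ⊛ sg g) n                       ≡⟨ sg-⊛ c g n ⟨
  sg (c ⊛ g) n                       ≡⟨ sg-cong (𝔇-zero (c ⊛ g)) n ⟨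
  sg (𝔇 0 (c ⊛ g)) n                 ≡⟨ *-identityˡ (sg (𝔇 0 (c ⊛ g)) n) ⟨
  1ℚ * sg (𝔇 0 (c ⊛ g)) n            ∎
ψ-block (suc k) g n = begin
  δ (ψ (replicate k d ++ [ y ]) (sg g)) n
    ≡⟨ δ-cong (ψ-block k g) n ⟩
  δ (λ n → -1^ k * fromℕ (k !) * sg 𝔇g n) n
    ≡⟨ δ-scale (-1^ k * fromℕ (k !)) (sg 𝔇g) n ⟩
  -1^ k * fromℕ (k !) * δ (sg 𝔇g) n
    ≡⟨ cong (-1^ k * fromℕ (k !) *_) (trans (δ-sg 𝔇g n) (cong (λ p → - (-1^ n * p)) (sym (𝔇-suc k (c ⊛ g) n)))) ⟩
  -1^ k * fromℕ (k !) * - (-1^ n * (fromℕ (suc k) * p))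
    ≡⟨ solve 5 (λ s F e K p → s :* F :* (:- (e :* (K :* p))) := (:- s) :* (K :* F) :* (e :* p)) refl
         (-1^ k) (fromℕ (k !)) (-1^ n) (fromℕ (suc k)) p ⟩
  - -1^ k * (fromℕ (suc k) * fromℕ (k !)) * (-1^ n * p)
    ≡⟨ cong (λ F → - -1^ k * F * (-1^ n * p)) (!-suc k) ⟨
  - -1^ k * fromℕ (suc k !) * (-1^ n * p) ∎
  where
  𝔇g = 𝔇 k (c ⊛ g)
  p = 𝔇 (suc k) (c ⊛ g) n

-- c ⊛ _ and 𝔇 k are h ⊛ _ and δᵏ with the signs and the factorials removed.
E : Vec ℕ n → Series → ℚ
E []       g = g 0
E (k ∷ ks) g = E ks (𝔇 k (c ⊛ g))

-- The head of the vector is the rightmost block of the word and so acts first; its scalar then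
-- passes through the other blocks by linearity.
ψ-argument : ∀ (ks : Vec ℕ n) g → ψ (argument ks) (sg g) 0 ≡ -1^ (sum ks) * ∏! ks * E ks g
ψ-argument []       g = refl
ψ-argument (k ∷ ks) g = begin
  ψ (argument ks ++ replicate k d ++ [ y ]) (sg g) 0
    ≡⟨ cong (λ f → f 0) (ψ-++ (argument ks) (replicate k d ++ [ y ]) (sg g)) ⟩
  ψ (argument ks) (ψ (replicate k d ++ [ y ]) (sg g)) 0
    ≡⟨ ψ-cong (argument ks) (ψ-block k g) 0 ⟩
  ψ (argument ks) (λ n → -1^ k * fromℕ (k !) * sg (𝔇 k (c ⊛ g)) n) 0
    ≡⟨ ψ-scale (argument ks) (-1^ k * fromℕ (k !)) (sg (𝔇 k (c ⊛ g))) 0 ⟩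
  -1^ k * fromℕ (k !) * ψ (argument ks) (sg (𝔇 k (c ⊛ g))) 0
    ≡⟨ cong (-1^ k * fromℕ (k !) *_) (ψ-argument ks (𝔇 k (c ⊛ g))) ⟩
  -1^ k * fromℕ (k !) * (-1^ (sum ks) * ∏! ks * e)
    ≡⟨ solve 5 (λ a b s p e → a :* b :* (s :* p :* e) := a :* s :* (b :* p) :* e) refl
         (-1^ k) (fromℕ (k !)) (-1^ (sum ks)) (∏! ks) e ⟩
  -1^ k * -1^ (sum ks) * ∏! (k ∷ ks) * e
    ≡⟨ cong (λ s → s * ∏! (k ∷ ks) * e) (-1^-+ k (sum ks)) ⟨
  -1^ (k ℕ.+ sum ks) * ∏! (k ∷ ks) * e ∎
  where e = E ks (𝔇 k (c ⊛ g))

-- The induction needs an arbitrary g, which carries what the inner blocks have produced. One step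
-- multiplies g by c, the factor `T c` of `Q c`, and takes the coefficient of t₁ᵏ, which by Taylor
-- is again a series in the sum of the remaining variables.
E≡T⊗Q : ∀ (ks : Vec ℕ n) g → E ks g ≡ (T g ⊗ Q c) ks
E≡T⊗Q []       g = solve 1 (λ p → p := con 1ℚ :* p :* con 1ℚ :+ con 0ℚ) refl (g 0)
E≡T⊗Q (k ∷ ks) g = begin
  E ks (𝔇 k (c ⊛ g))
    ≡⟨ E≡T⊗Q ks (𝔇 k (c ⊛ g)) ⟩
  (T (𝔇 k (c ⊛ g)) ⊗ Q c) ks
    ≡⟨ ⊗-cong {σ = Q c} (λ r → sym (T-∷ (c ⊛ g) k r)) (λ _ → refl) ks ⟩
  ((λ r → T (c ⊛ g) (k ∷ r)) ⊗ Q c) ks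
    ≡⟨ ⊗-lift (T (c ⊛ g)) (Q c) k ks ⟨
  (T (c ⊛ g) ⊗ lift (Q c)) (k ∷ ks)
    ≡⟨ ⊗-cong {σ = lift (Q c)} (λ r → trans (T-cong (⊛-comm c g) r) (T-⊛ g c r)) (λ _ → refl) (k ∷ ks) ⟩
  (T g ⊗ T c ⊗ lift (Q c)) (k ∷ ks)
    ≡⟨ ⊗-assoc (T g) (T c) (lift (Q c)) (k ∷ ks) ⟩
  (T g ⊗ Q c) (k ∷ ks) ∎

inY-∷ʳ-y : ∀ u → inY (u ++ [ y ]) ≡ true
inY-∷ʳ-y []          = refl
inY-∷ʳ-y (d ∷ [])    = refl
inY-∷ʳ-y (y ∷ [])    = refl
inY-∷ʳ-y (l ∷ m ∷ u) = trans (inY-∷ l m (u ++ [ y ])) (inY-∷ʳ-y (m ∷ u))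

argument∈Y : ∀ (ks : Vec ℕ n) → inY (argument ks) ≡ true
argument∈Y []       = refl
argument∈Y (k ∷ ks) = trans (cong inY (sym (List.++-assoc (argument ks) (replicate k d) [ y ])))
  (inY-∷ʳ-y (argument ks ++ replicate k d))

ζ-EMS≡ : ∀ D (ks : Vec ℕ n) → ζ-EMS D ks ≡ -1^ (sum ks) * ∏! ks * Q c ks
ζ-EMS≡ D ks = begin
  ζ-EMS D ks
    ≡⟨ proj₂ (uniqueness D (suc (length w)) w ℕ.≤-refl (argument∈Y ks)) (ℤ.+ 0) ⟩
  ψ w (const 1ℚ) 0
    -- The constant 1 is even, so it has the form `sg g` that `ψ-argument` expects.
    ≡⟨ ψ-cong w (λ { zero → refl ; (suc m) → sym (*-zeroʳ (-1^ (suc m))) }) 0 ⟩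
  ψ w (sg (const 1ℚ)) 0
    ≡⟨ ψ-argument ks (const 1ℚ) ⟩
  -1^ (sum ks) * ∏! ks * E ks (const 1ℚ)
    ≡⟨ cong (-1^ (sum ks) * ∏! ks *_) (trans (E≡T⊗Q ks (const 1ℚ)) (trans
         (⊗-cong {σ = Q c} T-1 (λ _ → refl) ks) (⊗-identityˡ (Q c) ks))) ⟩
  -1^ (sum ks) * ∏! ks * Q c ks ∎
  where w = argument ks

-- Generating function and explicit formula

Q-cong : f ≗ g → ∀ {n} → Q f {n} ≗ Q g
Q-cong f≗g {zero}  k = refl
Q-cong f≗g {suc n} k = ⊗-cong (T-cong f≗g) (lift-cong (Q-cong f≗g)) k

Z-weight : ∀ (k : Vec ℕ n) →
  Vec.foldr′ (λ kᵢ r → (-1^ kᵢ * 1/[ kᵢ ]!) * r) 1ℚ k * (-1^ (sum k) * ∏! k) ≡ 1ℚ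
Z-weight []       = refl
Z-weight (k ∷ ks) = begin
  -1^ k * 1/[ k ]! * W * (-1^ (k ℕ.+ sum ks) * (fromℕ (k !) * ∏! ks))
    ≡⟨ cong (λ s → -1^ k * 1/[ k ]! * W * (s * (fromℕ (k !) * ∏! ks))) (-1^-+ k (sum ks)) ⟩
  -1^ k * 1/[ k ]! * W * (-1^ k * -1^ (sum ks) * (fromℕ (k !) * ∏! ks))
    ≡⟨ solve 6 (λ s a W S b P → s :* a :* W :* (s :* S :* (b :* P)) := s :* s :* (a :* b) :* (W :* (S :* P))) refl
         (-1^ k) 1/[ k ]! W (-1^ (sum ks)) (fromℕ (k !)) (∏! ks) ⟩
  -1^ k * -1^ k * (1/[ k ]! * fromℕ (k !)) * (W * (-1^ (sum ks) * ∏! ks))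
    ≡⟨ cong₂ _*_ (cong₂ _*_ (-1^-square k) (1/n!*n!≡1 k)) (Z-weight ks) ⟩
  1ℚ ∎
  where W = Vec.foldr′ (λ kᵢ r → (-1^ kᵢ * 1/[ kᵢ ]!) * r) 1ℚ ks

-- summand k ν divided by k₁! ⋯ kₙ!.
weight : Triangle n → ℚ
weight []      = 1ℚ
weight (r ∷ ν) = T c r * weight ν

-- The coefficient c m is that of I at m + 1, namely B_{m+1} / (m+1)!. The remaining m! is the
-- numerator of the multinomial coefficient in `T c`.
B/suc : ∀ m → B (suc m) * (ℤ.+ 1 / suc m) ≡ fromℕ (m !) * c m
B/suc m = begin
  fromℕ (suc m !) * c m * (ℤ.+ 1 / suc m)
    ≡⟨ cong (λ F → F * c m * (ℤ.+ 1 / suc m)) (!-suc m) ⟩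
  fromℕ (suc m) * fromℕ (m !) * c m * (ℤ.+ 1 / suc m)
    ≡⟨ solve 4 (λ K F p q → K :* F :* p :* q := q :* K :* (F :* p)) refl (fromℕ (suc m)) (fromℕ (m !)) (c m) (ℤ.+ 1 / suc m) ⟩
  (ℤ.+ 1 / suc m) * fromℕ (suc m) * (fromℕ (m !) * c m)
    ≡⟨ cong (_* (fromℕ (m !) * c m)) (1/n*n≡1 (suc m)) ⟩
  1ℚ * (fromℕ (m !) * c m)
    ≡⟨ *-identityˡ (fromℕ (m !) * c m) ⟩
  fromℕ (m !) * c m ∎

summand≡ : ∀ (ks : Vec ℕ n) ν → summand ks ν ≡ ∏! ks * weight ν
summand≡ []       []      = refl
summand≡ (k ∷ ks) (r ∷ ν) = trans
  (cong₂ (λ b s → fromℕ (k !) * 1/∏! r * b * s) (B/suc (sum r)) (summand≡ ks ν))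
  (solve 6 (λ K R F p P w → K :* R :* (F :* p) :* (P :* w) := K :* P :* (F :* R :* p :* w)) refl
    (fromℕ (k !)) (1/∏! r) (fromℕ (sum r !)) (c (sum r)) (∏! ks) (weight ν))

-- The first row is the exponent vector taken from `T c`. Its first entry must be k because the
-- other factor is free of t₁; its rest r runs over `below ks`, and the remaining rows account for
-- ks - r, exactly as in the Cauchy product.
∑-families : ∀ (ks : Vec ℕ n) → ∑ (families ks) weight ≡ Q c ks
∑-families         []       = refl
∑-families {suc n} (k ∷ ks) = begin
  ∑ (families (k ∷ ks)) weight
    ≡⟨ ∑-concatMap rows (below ks) weight ⟩
  ∑ (below ks) (λ r → ∑ (rows r) weight)
    ≡⟨ ∑-cong (below ks) (λ r → trans (∑-map ((k ∷ r) ∷_) (families (Vec.zipWith _∸_ ks r)) weight) (trans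
         (∑-*ˡ (families (Vec.zipWith _∸_ ks r)) (T c (k ∷ r)) weight)
         (cong (T c (k ∷ r) *_) (∑-families (Vec.zipWith _∸_ ks r))))) ⟩
  ((λ r → T c (k ∷ r)) ⊗ Q c) ks
    ≡⟨ ⊗-lift (T c) (Q c) k ks ⟨
  Q c (k ∷ ks) ∎
  where
  rows : Vec ℕ n → List (Triangle (suc n))
  rows r = map ((k ∷ r) ∷_) (families (Vec.zipWith _∸_ ks r))

corollary3p9 : (D : BirkhoffDecomposition) (n : ℕ) → n ≥ 1 →
    (Z-EMS D n ≗ ∏ᴹ (allFin n) (λ i → substitute factor (tailSum i)))
    × ((k : Vec ℕ n) → ζ-EMS D k ≡ -1^ (sum k) * ∑ (families k) (summand k))
corollary3p9 D n _ = generating , explicit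
  where
  generating : Z-EMS D n ≗ ∏ᴹ (allFin n) (λ i → substitute factor (tailSum i))
  generating k = begin
    Z-EMS D n k
      ≡⟨ cong (W *_) (ζ-EMS≡ D k) ⟩
    W * (-1^ (sum k) * ∏! k * Q c k)
      ≡⟨ *-assoc W (-1^ (sum k) * ∏! k) (Q c k) ⟨
    W * (-1^ (sum k) * ∏! k) * Q c k
      ≡⟨ cong (_* Q c k) (Z-weight k) ⟩
    1ℚ * Q c k
      ≡⟨ *-identityˡ (Q c k) ⟩
    Q c k
      ≡⟨ Q-cong factor≗c k ⟨
    Q factor k
      ≡⟨ ∏ᴹ-substitute factor n k ⟨
    ∏ᴹ (allFin n) (λ i → substitute factor (tailSum i)) k ∎
    where W = Vec.foldr′ (λ kᵢ r → (-1^ kᵢ * 1/[ kᵢ ]!) * r) 1ℚ k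
  explicit : (k : Vec ℕ n) → ζ-EMS D k ≡ -1^ (sum k) * ∑ (families k) (summand k)
  explicit k = begin
    ζ-EMS D k
      ≡⟨ ζ-EMS≡ D k ⟩
    -1^ (sum k) * ∏! k * Q c k
      ≡⟨ *-assoc (-1^ (sum k)) (∏! k) (Q c k) ⟩
    -1^ (sum k) * (∏! k * Q c k)
      ≡⟨ cong (λ q → -1^ (sum k) * (∏! k * q)) (∑-families k) ⟨
    -1^ (sum k) * (∏! k * ∑ (families k) weight)
      ≡⟨ cong (-1^ (sum k) *_) (trans (sym (∑-*ˡ (families k) (∏! k) weight))
           (∑-cong (families k) (λ ν → sym (summand≡ k ν)))) ⟩
    -1^ (sum k) * ∑ (families k) (summand k) ∎
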